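{- Let $p<q$ be primes and let $P(x)=I(\varGamma(\mathbb{Z}_{pq}),x)$. Then every complex zero $x$ of $P(x)$ lies in the open annular region $r_1<|x|<r_2$, where $$r_1=\frac{R-1}{R^{q-1}+R^{p-1}-2}\quad\text{and}\quad r_2=R+1,\quad\text{with}\quad R=2^{1/(q-p)}.$$
   Context: For a positive integer $n$, the zero divisor graph $\varGamma(\mathbb{Z}_n)$ is the simple undirected graph whose vertices are the non-zero zero divisors of the ring $\mathbb{Z}_n$ of integers modulo $n$ (non-zero $a$ such that $ab=0$ for some non-zero $b$), two distinct vertices $a,b$ being adjacent if and only if $ab=0$ in $\mathbb{Z}_n$. An independent set of a finite graph $G$ is a set of vertices no two of which are adjacent (the empty set included); $\alpha(G)$ is the maximum size of an independent set, and $s_k(G)$ is the number of independent sets of size $k$. The independence polynomial of $G$ is $I(G,x)=\sum_{k=0}^{\alpha(G)} s_k(G)x^k$. -}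

module Defs where

open import Algebra.Bundles.Raw using (RawSemiring)
import Algebra.Definitions.RawSemiring as RawSemiringDefs
open import Data.Bool.Base using (if_then_else_)
open import Data.Fin.Base using (Fin; toℕ)
open import Data.Fin.Properties using (all?; any?; nonZeroIndex)
import Data.Fin.Properties as Fin
open import Data.Fin.Subset using (Subset; inside; outside; _∈_; _⊆_; ∣_∣)
open import Data.Fin.Subset.Properties using (_∈?_; _⊆?_)
import Data.Integer.Base as ℤ
import Data.Integer.Properties as ℤ
open import Data.List.Base using (List; []; _∷_; [_]; _++_; map; filter; length)
open import Data.List.Extrema.Nat using (max)
open import Data.Nat.Base as ℕ using (ℕ; zero; suc; NonZero)
open import Data.Nat.Coprimality using (1-coprimeTo)
open import Data.Nat.DivMod using (_mod_)
open import Data.Nat.Primality using (Prime; prime⇒nonTrivial)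
import Data.Nat.Properties as ℕ
open import Data.Product.Base using (_×_; _,_; proj₁; proj₂; ∃)
open import Data.Rational.Base as ℚ
  using (ℚ; mkℚ; 0ℚ; 1ℚ; ½; _+_; _*_; -_; _-_; _≤_; _<_)
  renaming (∣_∣ to abs)
import Data.Rational.Properties as ℚ
open import Data.Rational.Solver using (module +-*-Solver)
import Data.Rational.Unnormalised.Base as ℚᵘ
import Data.Rational.Unnormalised.Properties as ℚᵘ
open import Data.Sum.Base using (_⊎_; inj₁; inj₂)
open import Data.Vec.Base as Vec using ([]; _∷_)
open import Function.Base using (_∘_)
open import Level using (0ℓ)
open import Relation.Binary.Core using (Rel)
open import Relation.Binary.Definitions using (Decidable; Symmetric; Irreflexive)
open import Relation.Binary.PropositionalEquality
  using (_≡_; _≢_; refl; sym; trans; cong; cong₂; subst; subst₂)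
open import Relation.Nullary using (¬_; Dec; yes; no; does; contradiction)
open import Relation.Nullary.Decidable using (¬?; _×-dec_; _→-dec_)

------------------------------------------------------------------------
-- Rational arithmetic

open RawSemiringDefs ℚ.+-*-rawSemiring using () renaming (_^_ to _^ℚ_; _×_ to _×ℚ_)
open +-*-Solver using (solve; _:+_; _:*_; _:-_; :-_; _:=_; con)

module RationalLemmas where
  pos+pos : ∀ {a b} → 0ℚ < a → 0ℚ < b → 0ℚ < a + b
  pos+pos = ℚ.+-mono-<

  pos*pos : ∀ {a b} → 0ℚ < a → 0ℚ < b → 0ℚ < a * b
  pos*pos {a} {b} 0<a 0<b =
    ℚ.positive⁻¹ (a * b) {{ℚ.pos*pos⇒pos a {{ℚ.positive 0<a}} b {{ℚ.positive 0<b}}}}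

  0≤* : ∀ {a b} → 0ℚ ≤ a → 0ℚ ≤ b → 0ℚ ≤ a * b
  0≤* {a} {b} 0≤a 0≤b =
    ℚ.nonNegative⁻¹ (a * b)
      {{ℚ.nonNeg*nonNeg⇒nonNeg a {{ℚ.nonNegative 0≤a}} b {{ℚ.nonNegative 0≤b}}}}

  *-mono-≤ : ∀ {a b c d} → 0ℚ ≤ c → 0ℚ ≤ b → a ≤ b → c ≤ d → a * c ≤ b * d
  *-mono-≤ {a} {b} {c} {d} 0≤c 0≤b a≤b c≤d = ℚ.≤-trans
    (ℚ.*-monoʳ-≤-nonNeg c {{ℚ.nonNegative 0≤c}} a≤b)
    (ℚ.*-monoˡ-≤-nonNeg b {{ℚ.nonNegative 0≤b}} c≤d)

  half : ∀ ε → ½ * ε + ½ * ε ≡ ε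
  half = solve 1 (λ e → con ½ :* e :+ con ½ :* e := e) refl

  half-pos : ∀ {ε} → 0ℚ < ε → 0ℚ < ½ * ε
  half-pos = pos*pos {½} (ℚ.*<* (ℤ.+<+ (ℕ.s≤s ℕ.z≤n)))

  0<1 : 0ℚ < 1ℚ
  0<1 = ℚ.*<* (ℤ.+<+ (ℕ.s≤s ℕ.z≤n))

  abs≤ : ∀ p → p ≤ abs p
  abs≤ p with ℚ.≤-total 0ℚ p
  ... | inj₁ 0≤p = ℚ.≤-reflexive (sym (ℚ.0≤p⇒∣p∣≡p 0≤p))
  ... | inj₂ p≤0 = ℚ.≤-trans p≤0 (ℚ.0≤∣p∣ p)

  abs-swap : ∀ a b → abs (a - b) ≡ abs (b - a)
  abs-swap a b = trans
    (cong abs (solve 2 (λ x y → x :- y := :- (y :- x)) refl a b))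
    (ℚ.∣-p∣≡∣p∣ (b - a))

  abs<⇒< : ∀ {a b c} → abs (a - b) < c → a < b + c
  abs<⇒< {a} {b} {c} h = subst (_< b + c)
    (solve 2 (λ x y → y :+ (x :- y) := x) refl a b)
    (ℚ.+-monoʳ-< b (ℚ.≤-<-trans (abs≤ (a - b)) h))

  <⇒abs< : ∀ {a b c} → a < b + c → b < a + c → abs (a - b) < c
  <⇒abs< {a} {b} {c} a<b+c b<a+c with ℚ.∣p∣≡p∨∣p∣≡-p (a - b)
  ... | inj₁ e = subst₂ _<_ (sym e) (solve 2 (λ y z → (y :+ z) :- y := z) refl b c)
                   (ℚ.+-monoˡ-< (- b) a<b+c)
  ... | inj₂ e = subst₂ _<_
                   (trans (solve 2 (λ x y → y :- x := :- (x :- y)) refl a b) (sym e))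
                   (solve 2 (λ x z → (x :+ z) :- x := z) refl a c)
                   (ℚ.+-monoˡ-< (- a) b<a+c)

  0≤^ : ∀ k {a} → 0ℚ ≤ a → 0ℚ ≤ a ^ℚ k
  0≤^ zero    0≤a = ℚ.<⇒≤ 0<1
  0≤^ (suc k) 0≤a = 0≤* 0≤a (0≤^ k 0≤a)

  0<^ : ∀ k {a} → 0ℚ < a → 0ℚ < a ^ℚ k
  0<^ zero    0<a = 0<1
  0<^ (suc k) 0<a = pos*pos 0<a (0<^ k 0<a)

  ^-mono-≤ : ∀ k {a b} → 0ℚ ≤ a → a ≤ b → a ^ℚ k ≤ b ^ℚ k
  ^-mono-≤ zero    0≤a a≤b = ℚ.≤-refl
  ^-mono-≤ (suc k) 0≤a a≤b =
    *-mono-≤ (0≤^ k 0≤a) (ℚ.≤-trans 0≤a a≤b) a≤b (^-mono-≤ k 0≤a a≤b)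

  ^-cancel-< : ∀ k {a b} → 0ℚ ≤ b → a ^ℚ k < b ^ℚ k → a < b
  ^-cancel-< k {a} {b} 0≤b h with a ℚ.<? b
  ... | yes a<b = a<b
  ... | no  a≮b = contradiction
    (ℚ.<-≤-trans h (^-mono-≤ k 0≤b (ℚ.≮⇒≥ a≮b))) (ℚ.<-irrefl refl)

  1≤^ : ∀ k {a} → 1ℚ ≤ a → 1ℚ ≤ a ^ℚ k
  1≤^ zero    1≤a = ℚ.≤-refl
  1≤^ (suc k) 1≤a =
    *-mono-≤ {1ℚ} {_} {1ℚ} (ℚ.<⇒≤ 0<1) (ℚ.≤-trans (ℚ.<⇒≤ 0<1) 1≤a) 1≤a (1≤^ k 1≤a)

  ≤^ : ∀ k .{{_ : NonZero k}} {a} → 1ℚ ≤ a → a ≤ a ^ℚ k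
  ≤^ (suc k) {a} 1≤a = subst (_≤ a * (a ^ℚ k)) (ℚ.*-identityʳ a)
    (ℚ.*-monoˡ-≤-nonNeg a {{ℚ.nonNegative (ℚ.≤-trans (ℚ.<⇒≤ 0<1) 1≤a)}} (1≤^ k 1≤a))

  ^-superadditive : ∀ k .{{_ : NonZero k}} {a e} → 0ℚ ≤ a → 0ℚ ≤ e →
                    a ^ℚ k + e ^ℚ k ≤ (a + e) ^ℚ k
  ^-superadditive (suc zero) {a} {e} 0≤a 0≤e = ℚ.≤-reflexive
    (solve 2 (λ x y → x :* con 1ℚ :+ y :* con 1ℚ := (x :+ y) :* con 1ℚ) refl a e)
  ^-superadditive (suc (suc j)) {a} {e} 0≤a 0≤e = ℚ.≤-trans
    (subst₂ _≤_ (ℚ.+-identityʳ (a * u + e * v))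
      (solve 4 (λ x y z w →
         (x :* z :+ y :* w) :+ (x :* w :+ y :* z) := (x :+ y) :* (z :+ w)) refl a e u v)
      (ℚ.+-monoʳ-≤ (a * u + e * v)
        (ℚ.+-mono-≤ (0≤* 0≤a (0≤^ (suc j) 0≤e)) (0≤* 0≤e (0≤^ (suc j) 0≤a)))))
    (ℚ.*-monoˡ-≤-nonNeg (a + e) {{ℚ.nonNegative (ℚ.+-mono-≤ 0≤a 0≤e)}}
      (^-superadditive (suc j) 0≤a 0≤e))
    where
    u = a ^ℚ suc j
    v = e ^ℚ suc j

open RationalLemmas

1/suc : ℕ → ℚ
1/suc n = mkℚ (ℤ.+ 1) n (1-coprimeTo (suc n))

module UnitFractionLemmas where
  0<1/suc : ∀ n → 0ℚ < 1/suc n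
  0<1/suc n = ℚ.*<* (ℤ.+<+ (ℕ.s≤s ℕ.z≤n))

  archimedean : ∀ {ε} → 0ℚ < ε → ∃ λ N → ∀ n → N ℕ.≤ n → 1/suc n ≤ ε
  archimedean {mkℚ (ℤ.+ suc a) d _} _ = d , λ n d≤n → ℚ.*≤* (ℤ.+≤+
    (ℕ.≤-trans (ℕ.≤-reflexive (ℕ.+-identityʳ (suc d)))
      (ℕ.≤-trans (ℕ.s≤s d≤n) (ℕ.m≤m+n (suc n) (a ℕ.* suc n)))))
  archimedean {mkℚ (ℤ.+ zero)  d _} (ℚ.*<* (ℤ.+<+ ()))
  archimedean {mkℚ ℤ.-[1+ a ] d _} (ℚ.*<* ())

open UnitFractionLemmas

-- The value at 0 is irrelevant: it is only reached by initial terms of a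
-- sequence that is eventually bounded away from 0.
invℚ : ℚ → ℚ
invℚ p with p ℚ.≟ 0ℚ
... | yes _   = 0ℚ
... | no  p≢0 = (ℚ.1/ p) {{ℚ.≢-nonZero p≢0}}

module InverseLemmas where
  invℚ-inverse : ∀ {p} → 0ℚ < p → invℚ p * p ≡ 1ℚ
  invℚ-inverse {p} 0<p with p ℚ.≟ 0ℚ
  ... | yes p≡0 = contradiction (sym p≡0) (ℚ.<⇒≢ 0<p)
  ... | no  p≢0 = ℚ.*-inverseˡ p {{ℚ.≢-nonZero p≢0}}

  invℚ-pos : ∀ {p} → 0ℚ < p → 0ℚ < invℚ p
  invℚ-pos {p} 0<p = ℚ.*-cancelʳ-<-nonNeg p {{ℚ.nonNegative (ℚ.<⇒≤ 0<p)}}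
    (subst₂ _<_ (sym (ℚ.*-zeroˡ p)) (sym (invℚ-inverse 0<p)) 0<1)

  invℚ-bound : ∀ {ε p} → 0ℚ < ε → ε < p → invℚ p * ε ≤ 1ℚ
  invℚ-bound {ε} {p} 0<ε ε<p = subst (invℚ p * ε ≤_) (invℚ-inverse 0<p)
    (ℚ.*-monoˡ-≤-nonNeg (invℚ p) {{ℚ.nonNegative (ℚ.<⇒≤ (invℚ-pos 0<p))}} (ℚ.<⇒≤ ε<p))
    where 0<p = ℚ.<-trans 0<ε ε<p

open InverseLemmas

------------------------------------------------------------------------
-- Real numbers: Cauchy sequences of rationals, up to _≈ᴿ_

IsCauchy : (ℕ → ℚ) → Set
IsCauchy s = ∀ ε → 0ℚ < ε → ∃ λ N → ∀ m n → N ℕ.≤ m → N ℕ.≤ n → abs (s m - s n) < ε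

record ℝ : Set where
  constructor mkℝ
  field
    seq    : ℕ → ℚ
    cauchy : IsCauchy seq

open ℝ public

infix 4 _≈ᴿ_ _<ᴿ_

_≈ᴿ_ : ℝ → ℝ → Set
x ≈ᴿ y = ∀ ε → 0ℚ < ε → ∃ λ N → ∀ n → N ℕ.≤ n → abs (seq x n - seq y n) < ε

_<ᴿ_ : ℝ → ℝ → Set
x <ᴿ y = ∃ λ ε → 0ℚ < ε × ∃ λ N → ∀ n → N ℕ.≤ n → seq x n + ε < seq y n

fromℚ : ℚ → ℝ
fromℚ p = mkℝ (λ _ → p) λ ε 0<ε → 0 , λ _ _ _ _ →
  subst (_< ε) (sym (cong abs (ℚ.+-inverseʳ p))) 0<ε

0ᴿ 1ᴿ : ℝ
0ᴿ = fromℚ 0ℚ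
1ᴿ = fromℚ 1ℚ

module CauchyLemmas where
  +-cauchy : ∀ s t → IsCauchy s → IsCauchy t → IsCauchy (λ n → s n + t n)
  +-cauchy s t cs ct ε 0<ε with cs (½ * ε) (half-pos 0<ε) | ct (½ * ε) (half-pos 0<ε)
  ... | M , hs | N , ht = M ℕ.⊔ N , λ m n M⊔N≤m M⊔N≤n →
    subst₂ _<_
      (cong abs (sym (solve 4 (λ a b c d →
         (a :+ b) :- (c :+ d) := (a :- c) :+ (b :- d)) refl (s m) (t m) (s n) (t n))))
      (half ε)
      (ℚ.≤-<-trans (ℚ.∣p+q∣≤∣p∣+∣q∣ (s m - s n) (t m - t n))
        (ℚ.+-mono-<
          (hs m n (ℕ.m⊔n≤o⇒m≤o M N M⊔N≤m) (ℕ.m⊔n≤o⇒m≤o M N M⊔N≤n))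
          (ht m n (ℕ.m⊔n≤o⇒n≤o M N M⊔N≤m) (ℕ.m⊔n≤o⇒n≤o M N M⊔N≤n))))

  neg-cauchy : ∀ s → IsCauchy s → IsCauchy (λ n → - s n)
  neg-cauchy s cs ε 0<ε with cs ε 0<ε
  ... | N , h = N , λ m n N≤m N≤n → subst (_< ε)
    (cong abs (solve 2 (λ a b → a :- b := :- b :- (:- a)) refl (s n) (s m)))
    (h n m N≤n N≤m)

  bounded : ∀ s → IsCauchy s → ∃ λ B → 0ℚ < B × ∃ λ N → ∀ n → N ℕ.≤ n → abs (s n) < B
  bounded s cs with cs 1ℚ 0<1
  ... | N , h = abs (s N) + 1ℚ
    , ℚ.+-mono-≤-< (ℚ.0≤∣p∣ (s N)) 0<1
    , N , λ n N≤n → subst (_< abs (s N) + 1ℚ)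
        (cong abs (solve 2 (λ a b → a :+ (b :- a) := b) refl (s N) (s n)))
        (ℚ.≤-<-trans (ℚ.∣p+q∣≤∣p∣+∣q∣ (s N) (s n - s N))
          (ℚ.+-monoʳ-< (abs (s N)) (h n N N≤n ℕ.≤-refl)))

  *-close : ∀ a b c d A B η → abs a < A → abs d < B → 0ℚ < B →
            abs (a - c) < η → abs (b - d) < η →
            abs (a * b - c * d) < A * η + B * η
  *-close a b c d A B η |a|<A |d|<B 0<B |a-c|<η |b-d|<η = subst (_< A * η + B * η)
    (cong abs (solve 4 (λ a b c d →
      a :* (b :- d) :+ d :* (a :- c) := a :* b :- c :* d) refl a b c d))
    (ℚ.≤-<-trans (ℚ.∣p+q∣≤∣p∣+∣q∣ (a * (b - d)) (d * (a - c)))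
      (subst₂ (λ u v → u + v < A * η + B * η)
        (sym (ℚ.∣p*q∣≡∣p∣*∣q∣ a (b - d)))
        (sym (ℚ.∣p*q∣≡∣p∣*∣q∣ d (a - c)))
        (ℚ.+-mono-≤-<
          (*-mono-≤ (ℚ.0≤∣p∣ (b - d)) (ℚ.≤-trans (ℚ.0≤∣p∣ a) (ℚ.<⇒≤ |a|<A))
            (ℚ.<⇒≤ |a|<A) (ℚ.<⇒≤ |b-d|<η))
          (ℚ.≤-<-trans
            (ℚ.*-monoʳ-≤-nonNeg (abs (a - c)) {{ℚ.nonNegative (ℚ.0≤∣p∣ (a - c))}}
              (ℚ.<⇒≤ |d|<B))
            (ℚ.*-monoʳ-<-pos B {{ℚ.positive 0<B}} |a-c|<η)))))

  split : ∀ A B ε → 0ℚ < A + B →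
          A * (ε * invℚ (A + B)) + B * (ε * invℚ (A + B)) ≡ ε
  split A B ε 0<A+B = trans
    (solve 4 (λ a b e i → a :* (e :* i) :+ b :* (e :* i) := e :* (i :* (a :+ b)))
      refl A B ε (invℚ (A + B)))
    (trans (cong (ε *_) (invℚ-inverse 0<A+B)) (ℚ.*-identityʳ ε))

  *-cauchy : ∀ s t → IsCauchy s → IsCauchy t → IsCauchy (λ n → s n * t n)
  *-cauchy s t cs ct ε 0<ε = go (bounded s cs) (bounded t ct)
    where
    go : (∃ λ B → 0ℚ < B × ∃ λ N → ∀ n → N ℕ.≤ n → abs (s n) < B) →
         (∃ λ B → 0ℚ < B × ∃ λ N → ∀ n → N ℕ.≤ n → abs (t n) < B) →
         ∃ λ N → ∀ m n → N ℕ.≤ m → N ℕ.≤ n → abs (s m * t m - s n * t n) < ε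
    go (A , 0<A , K , |s|<A) (B , 0<B , L , |t|<B) = combine (cs η 0<η) (ct η 0<η)
      where
      η : ℚ
      η = ε * invℚ (A + B)
      0<η : 0ℚ < η
      0<η = pos*pos 0<ε (invℚ-pos (pos+pos 0<A 0<B))
      combine : (∃ λ N → ∀ m n → N ℕ.≤ m → N ℕ.≤ n → abs (s m - s n) < η) →
                (∃ λ N → ∀ m n → N ℕ.≤ m → N ℕ.≤ n → abs (t m - t n) < η) →
                ∃ λ N → ∀ m n → N ℕ.≤ m → N ℕ.≤ n → abs (s m * t m - s n * t n) < ε
      combine (M , hs) (N , ht) = (K ℕ.⊔ L) ℕ.⊔ (M ℕ.⊔ N) , λ m n ≤m ≤n →
        subst (abs (s m * t m - s n * t n) <_) (split A B ε (pos+pos 0<A 0<B))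
          (*-close (s m) (t m) (s n) (t n) A B η
            (|s|<A m (ℕ.m⊔n≤o⇒m≤o K L (ℕ.m⊔n≤o⇒m≤o (K ℕ.⊔ L) (M ℕ.⊔ N) ≤m)))
            (|t|<B n (ℕ.m⊔n≤o⇒n≤o K L (ℕ.m⊔n≤o⇒m≤o (K ℕ.⊔ L) (M ℕ.⊔ N) ≤n)))
            0<B
            (hs m n (ℕ.m⊔n≤o⇒m≤o M N (ℕ.m⊔n≤o⇒n≤o (K ℕ.⊔ L) (M ℕ.⊔ N) ≤m))
                    (ℕ.m⊔n≤o⇒m≤o M N (ℕ.m⊔n≤o⇒n≤o (K ℕ.⊔ L) (M ℕ.⊔ N) ≤n)))
            (ht m n (ℕ.m⊔n≤o⇒n≤o M N (ℕ.m⊔n≤o⇒n≤o (K ℕ.⊔ L) (M ℕ.⊔ N) ≤m))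
                    (ℕ.m⊔n≤o⇒n≤o M N (ℕ.m⊔n≤o⇒n≤o (K ℕ.⊔ L) (M ℕ.⊔ N) ≤n))))

  reciprocal-close : ∀ a b i j δ ε → i * a ≡ 1ℚ → j * b ≡ 1ℚ → 0ℚ < i → 0ℚ < j →
                     i * δ ≤ 1ℚ → j * δ ≤ 1ℚ → 0ℚ < δ → 0ℚ < ε →
                     abs (b - a) < ε * (δ * δ) → abs (i - j) < ε
  reciprocal-close a b i j δ ε ia≡1 jb≡1 0<i 0<j iδ≤1 jδ≤1 0<δ 0<ε |b-a|<εδδ =
    subst (λ z → abs z < ε) difference
      (subst (_< ε)
        (trans (cong (abs (b - a) *_) (sym (ℚ.0≤p⇒∣p∣≡p (ℚ.<⇒≤ 0<ij))))
               (sym (ℚ.∣p*q∣≡∣p∣*∣q∣ (b - a) (i * j))))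
        (ℚ.<-≤-trans (ℚ.*-monoˡ-<-pos (i * j) {{ℚ.positive 0<ij}} |b-a|<εδδ) ≤ε))
    where
    0<ij : 0ℚ < i * j
    0<ij = pos*pos 0<i 0<j
    difference : (b - a) * (i * j) ≡ i - j
    difference = trans
      (solve 4 (λ x y u v → (y :- x) :* (u :* v) := u :* (v :* y) :- v :* (u :* x))
        refl a b i j)
      (cong₂ _-_
        (trans (cong (i *_) jb≡1) (ℚ.*-identityʳ i))
        (trans (cong (j *_) ia≡1) (ℚ.*-identityʳ j)))
    ≤ε : (ε * (δ * δ)) * (i * j) ≤ ε
    ≤ε = subst₂ _≤_
      (solve 4 (λ e d u v → e :* ((u :* d) :* (v :* d)) := (e :* (d :* d)) :* (u :* v))
        refl ε δ i j)
      (ℚ.*-identityʳ ε)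
      (ℚ.*-monoˡ-≤-nonNeg ε {{ℚ.nonNegative (ℚ.<⇒≤ 0<ε)}}
        (*-mono-≤ {i * δ} {1ℚ} {j * δ} {1ℚ}
          (ℚ.<⇒≤ (pos*pos 0<j 0<δ)) (ℚ.<⇒≤ 0<1) iδ≤1 jδ≤1))

  invℚ-close : ∀ {a b δ ε} → 0ℚ < δ → 0ℚ < ε → δ < a → δ < b →
               abs (b - a) < ε * (δ * δ) → abs (invℚ a - invℚ b) < ε
  invℚ-close {a} {b} {δ} {ε} 0<δ 0<ε δ<a δ<b =
    reciprocal-close a b (invℚ a) (invℚ b) δ ε
      (invℚ-inverse 0<a) (invℚ-inverse 0<b) (invℚ-pos 0<a) (invℚ-pos 0<b)
      (invℚ-bound 0<δ δ<a) (invℚ-bound 0<δ δ<b) 0<δ 0<ε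
    where
    0<a = ℚ.<-trans 0<δ δ<a
    0<b = ℚ.<-trans 0<δ δ<b

  inv-cauchy : ∀ s → IsCauchy s → ∀ δ → 0ℚ < δ → ∀ M → (∀ n → M ℕ.≤ n → δ < s n) →
               IsCauchy (λ n → invℚ (s n))
  inv-cauchy s cs δ 0<δ M δ<s ε 0<ε with cs (ε * (δ * δ)) (pos*pos 0<ε (pos*pos 0<δ 0<δ))
  ... | N , h = M ℕ.⊔ N , λ m n ≤m ≤n →
    invℚ-close 0<δ 0<ε (δ<s m (ℕ.m⊔n≤o⇒m≤o M N ≤m)) (δ<s n (ℕ.m⊔n≤o⇒m≤o M N ≤n))
      (h n m (ℕ.m⊔n≤o⇒n≤o M N ≤n) (ℕ.m⊔n≤o⇒n≤o M N ≤m))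

open CauchyLemmas

infixl 6 _+ᴿ_ _-ᴿ_
infixl 7 _*ᴿ_ _/ᴿ_⟨_⟩
infix  8 -ᴿ_

_+ᴿ_ : ℝ → ℝ → ℝ
x +ᴿ y = mkℝ (λ n → seq x n + seq y n) (+-cauchy (seq x) (seq y) (cauchy x) (cauchy y))

_*ᴿ_ : ℝ → ℝ → ℝ
x *ᴿ y = mkℝ (λ n → seq x n * seq y n) (*-cauchy (seq x) (seq y) (cauchy x) (cauchy y))

-ᴿ_ : ℝ → ℝ
-ᴿ x = mkℝ (λ n → - seq x n) (neg-cauchy (seq x) (cauchy x))

_-ᴿ_ : ℝ → ℝ → ℝ
x -ᴿ y = x +ᴿ (-ᴿ y)

inverse : (y : ℝ) → 0ᴿ <ᴿ y → ℝ
inverse y (δ , 0<δ , M , h) = mkℝ (λ n → invℚ (seq y n))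
  (inv-cauchy (seq y) (cauchy y) δ 0<δ M λ n M≤n → subst (_< seq y n) (ℚ.+-identityˡ δ) (h n M≤n))

_/ᴿ_⟨_⟩ : ℝ → (y : ℝ) → 0ᴿ <ᴿ y → ℝ
x /ᴿ y ⟨ 0<y ⟩ = x *ᴿ inverse y 0<y

ℝ-rawSemiring : RawSemiring 0ℓ 0ℓ
ℝ-rawSemiring = record
  { Carrier = ℝ ; _≈_ = _≈ᴿ_ ; _+_ = _+ᴿ_ ; _*_ = _*ᴿ_ ; 0# = 0ᴿ ; 1# = 1ᴿ }

open RawSemiringDefs ℝ-rawSemiring public using () renaming (_^_ to _^ᴿ_)

2ᴿ : ℝ
2ᴿ = 1ᴿ +ᴿ 1ᴿ

-- The largest j ≤ fuel with (j δ)ᵏ ≤ x (or 0), multiplied by δ.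
rootSearch : (k : ℕ) (x δ : ℚ) (fuel : ℕ) → ℚ
rootSearch k x δ zero    = 0ℚ
rootSearch k x δ (suc j) =
  if does ((suc j ×ℚ δ) ^ℚ k ℚ.≤? x) then suc j ×ℚ δ else rootSearch k x δ j

-- The largest multiple a of 1/(n+1) with aᵏ ≤ x, and 0 if x < 0; the fuel
-- bounds a by ∣numerator of x∣ + 1, which exceeds x and is at least 1.
rootℚ : (k : ℕ) → ℚ → ℕ → ℚ
rootℚ k x n = rootSearch k x (1/suc n) (suc ℤ.∣ ℚ.↥ x ∣ ℕ.* suc n)

module RootLemmas where
  ×ℚ-nonNeg : ∀ j {δ} → 0ℚ ≤ δ → 0ℚ ≤ j ×ℚ δ
  ×ℚ-nonNeg zero    0≤δ = ℚ.≤-refl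
  ×ℚ-nonNeg (suc j) 0≤δ = ℚ.+-mono-≤ 0≤δ (×ℚ-nonNeg j 0≤δ)

  if-elim : ∀ {P : Set} (d : Dec P) (Q : ℚ → Set) {a b} →
            (P → Q a) → (¬ P → Q b) → Q (if does d then a else b)
  if-elim (yes p) Q f g = f p
  if-elim (no ¬p) Q f g = g ¬p

  rootSearch-nonNeg : ∀ k x δ j → 0ℚ ≤ δ → 0ℚ ≤ rootSearch k x δ j
  rootSearch-nonNeg k x δ zero    0≤δ = ℚ.≤-refl
  rootSearch-nonNeg k x δ (suc j) 0≤δ =
    if-elim ((suc j ×ℚ δ) ^ℚ k ℚ.≤? x) (0ℚ ≤_) {suc j ×ℚ δ} {rootSearch k x δ j}
      (λ _ → ×ℚ-nonNeg (suc j) {δ} 0≤δ) (λ _ → rootSearch-nonNeg k x δ j 0≤δ)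

  rootSearch-lower : ∀ k x δ j →
    rootSearch k x δ j ≡ 0ℚ ⊎ rootSearch k x δ j ^ℚ k ≤ x
  rootSearch-lower k x δ zero    = inj₁ refl
  rootSearch-lower k x δ (suc j) =
    if-elim ((suc j ×ℚ δ) ^ℚ k ℚ.≤? x) (λ a → a ≡ 0ℚ ⊎ a ^ℚ k ≤ x)
      {suc j ×ℚ δ} {rootSearch k x δ j}
      inj₂ (λ _ → rootSearch-lower k x δ j)

  rootSearch-upper : ∀ k x δ j → x < (suc j ×ℚ δ) ^ℚ k →
                     x < (rootSearch k x δ j + δ) ^ℚ k
  rootSearch-upper k x δ zero    h = subst (λ z → x < z ^ℚ k) (ℚ.+-comm δ 0ℚ) h
  rootSearch-upper k x δ (suc j) h =
    if-elim ((suc j ×ℚ δ) ^ℚ k ℚ.≤? x) (λ a → x < (a + δ) ^ℚ k)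
      {suc j ×ℚ δ} {rootSearch k x δ j}
      (λ _ → subst (λ z → x < z ^ℚ k) (ℚ.+-comm δ (suc j ×ℚ δ)) h)
      (λ ≰x → rootSearch-upper k x δ j (ℚ.≰⇒> ≰x))

  ×-1/suc : ∀ n j → ℚ.toℚᵘ (j ×ℚ 1/suc n) ℚᵘ.≃ ℚᵘ.mkℚᵘ (ℤ.+ j) n
  ×-1/suc n zero    = ℚᵘ.*≡* refl
  ×-1/suc n (suc j) = ℚᵘ.≃-trans (ℚ.toℚᵘ-homo-+ (1/suc n) (j ×ℚ 1/suc n))
    (ℚᵘ.≃-trans (ℚᵘ.+-congʳ (ℚᵘ.mkℚᵘ (ℤ.+ 1) n) (×-1/suc n j))
      (ℚᵘ.*≡* (trans
        (cong (ℤ._* ℤ.+ suc n) (sym (ℤ.*-distribʳ-+ (ℤ.+ suc n) (ℤ.+ 1) (ℤ.+ j))))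
        (ℤ.*-assoc (ℤ.+ suc j) (ℤ.+ suc n) (ℤ.+ suc n)))))

  module _ (x : ℚ) (n : ℕ) where
    private
      fuel = suc ℤ.∣ ℚ.↥ x ∣ ℕ.* suc n
      top  = suc fuel ×ℚ 1/suc n

    x<top : x < top
    x<top = ℚ.toℚᵘ-cancel-< (ℚᵘ.<-respʳ-≃ (ℚᵘ.≃-sym (×-1/suc n (suc fuel))) (below x refl))
      where
      below : ∀ y → y ≡ x → ℚ.toℚᵘ y ℚᵘ.< ℚᵘ.mkℚᵘ (ℤ.+ suc fuel) n
      below (mkℚ ℤ.-[1+ a ] d _) _    = ℚᵘ.*<* ℤ.-<+
      below (mkℚ (ℤ.+ a)    d _) refl = ℚᵘ.*<* (subst₂ ℤ._<_
        (ℤ.pos-* a (suc n)) (ℤ.pos-* (suc fuel) (suc d))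
        (ℤ.+<+ (ℕ.<-≤-trans (ℕ.s≤s (ℕ.*-monoˡ-≤ (suc n) (ℕ.n≤1+n a)))
          (ℕ.m≤m*n (suc (suc a ℕ.* suc n)) (suc d)))))

    1≤top : 1ℚ ≤ top
    1≤top = ℚ.toℚᵘ-cancel-≤ (ℚᵘ.≤-respʳ-≃ (ℚᵘ.≃-sym (×-1/suc n (suc fuel)))
      (ℚᵘ.*≤* (ℤ.+≤+ (subst₂ ℕ._≤_
        (sym (ℕ.+-identityʳ (suc n))) (sym (ℕ.*-identityʳ (suc fuel)))
        (ℕ.≤-trans (ℕ.m≤m+n (suc n) (ℤ.∣ ℚ.↥ x ∣ ℕ.* suc n)) (ℕ.n≤1+n fuel))))))

  rootℚ-nonNeg : ∀ k x n → 0ℚ ≤ rootℚ k x n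
  rootℚ-nonNeg k x n =
    rootSearch-nonNeg k x (1/suc n) (suc ℤ.∣ ℚ.↥ x ∣ ℕ.* suc n) (ℚ.<⇒≤ (0<1/suc n))

  rootℚ-lower : ∀ k x n → rootℚ k x n ≡ 0ℚ ⊎ rootℚ k x n ^ℚ k ≤ x
  rootℚ-lower k x n = rootSearch-lower k x (1/suc n) (suc ℤ.∣ ℚ.↥ x ∣ ℕ.* suc n)

  rootℚ-upper : ∀ k .{{_ : NonZero k}} x n → x < (rootℚ k x n + 1/suc n) ^ℚ k
  rootℚ-upper k x n = rootSearch-upper k x (1/suc n) (suc ℤ.∣ ℚ.↥ x ∣ ℕ.* suc n)
    (ℚ.<-≤-trans (x<top x n) (≤^ k (1≤top x n)))

  rootℚ-close : ∀ k .{{_ : NonZero k}} {η} → 0ℚ < η → ∀ x y m n → 1/suc n ≤ η →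
                abs (x - y) < η ^ℚ k → rootℚ k x m < rootℚ k y n + (η + η)
  rootℚ-close k {η} 0<η x y m n δ≤η |x-y|<ηᵏ = ℚ.<-≤-trans below
    (ℚ.≤-trans (ℚ.≤-reflexive (ℚ.+-assoc b δ η))
      (ℚ.+-monoʳ-≤ b (ℚ.+-monoˡ-≤ η δ≤η)))
    where
    a = rootℚ k x m
    b = rootℚ k y n
    δ = 1/suc n
    0<b+δ : 0ℚ < b + δ
    0<b+δ = ℚ.+-mono-≤-< (rootℚ-nonNeg k y n) (0<1/suc n)
    0<b+δ+η : 0ℚ < b + δ + η
    0<b+δ+η = pos+pos 0<b+δ 0<η
    below : a < b + δ + η
    below with rootℚ-lower k x m
    ... | inj₁ a≡0  = subst (_< b + δ + η) (sym a≡0) 0<b+δ+η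
    ... | inj₂ aᵏ≤x = ^-cancel-< k (ℚ.<⇒≤ 0<b+δ+η)
      (ℚ.≤-<-trans aᵏ≤x (ℚ.<-≤-trans (abs<⇒< |x-y|<ηᵏ)
        (ℚ.≤-trans (ℚ.+-monoˡ-≤ (η ^ℚ k) (ℚ.<⇒≤ (rootℚ-upper k y n)))
          (^-superadditive k (ℚ.<⇒≤ 0<b+δ) (ℚ.<⇒≤ 0<η)))))

  root-cauchy : ∀ k .{{_ : NonZero k}} s → IsCauchy s → IsCauchy (λ n → rootℚ k (s n) n)
  root-cauchy k s cs ε 0<ε
    with cs ((½ * ε) ^ℚ k) (0<^ k (half-pos 0<ε)) | archimedean (half-pos 0<ε)
  ... | M , hs | N , δ≤ = M ℕ.⊔ N , λ m n ≤m ≤n →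
    let M≤m = ℕ.m⊔n≤o⇒m≤o M N ≤m
        M≤n = ℕ.m⊔n≤o⇒m≤o M N ≤n
        N≤m = ℕ.m⊔n≤o⇒n≤o M N ≤m
        N≤n = ℕ.m⊔n≤o⇒n≤o M N ≤n
    in <⇒abs<
      (subst (λ e → rootℚ k (s m) m < rootℚ k (s n) n + e) (half ε)
        (rootℚ-close k (half-pos 0<ε) (s m) (s n) m n (δ≤ n N≤n) (hs m n M≤m M≤n)))
      (subst (λ e → rootℚ k (s n) n < rootℚ k (s m) m + e) (half ε)
        (rootℚ-close k (half-pos 0<ε) (s n) (s m) n m (δ≤ m N≤m) (hs n m M≤n M≤m)))

open RootLemmas

-- The non-negative k-th root of the positive part of x.
root : (k : ℕ) .{{_ : NonZero k}} → ℝ → ℝ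
root k x = mkℝ (λ n → rootℚ k (seq x n) n) (root-cauchy k (seq x) (cauchy x))

------------------------------------------------------------------------
-- Complex numbers

record ℂ : Set where
  constructor _+i_
  field
    re im : ℝ

open ℂ public

infix 4 _≈ᶜ_
infixl 6 _+ᶜ_
infixl 7 _*ᶜ_

_≈ᶜ_ : ℂ → ℂ → Set
z ≈ᶜ w = (re z ≈ᴿ re w) × (im z ≈ᴿ im w)

0ᶜ 1ᶜ : ℂ
0ᶜ = 0ᴿ +i 0ᴿ
1ᶜ = 1ᴿ +i 0ᴿ

_+ᶜ_ _*ᶜ_ : ℂ → ℂ → ℂ
z +ᶜ w = (re z +ᴿ re w) +i (im z +ᴿ im w)
z *ᶜ w = (re z *ᴿ re w -ᴿ im z *ᴿ im w) +i (re z *ᴿ im w +ᴿ im z *ᴿ re w)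

ℂ-rawSemiring : RawSemiring 0ℓ 0ℓ
ℂ-rawSemiring = record
  { Carrier = ℂ ; _≈_ = _≈ᶜ_ ; _+_ = _+ᶜ_ ; _*_ = _*ᶜ_ ; 0# = 0ᶜ ; 1# = 1ᶜ }

open RawSemiringDefs ℂ-rawSemiring public
  using () renaming (_^_ to _^ᶜ_; _×_ to _×ᶜ_; sum to sumᶜ)

modulus : ℂ → ℝ
modulus z = root 2 (re z *ᴿ re z +ᴿ im z *ᴿ im z)

------------------------------------------------------------------------
-- Finite simple graphs and the independence polynomial

-- The vertex set is a subset of the ambient set Fin n.
record SimpleGraph (n : ℕ) : Set₁ where
  infix 4 _~_ _~?_
  field
    vertices : Subset n
    _~_      : Rel (Fin n) 0ℓ
    _~?_     : Decidable _~_
    ~⇒∈      : ∀ {a b} → a ~ b → a ∈ vertices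
    ~-sym    : Symmetric _~_
    ~-irrefl : Irreflexive _≡_ _~_

subsets : ∀ n → List (Subset n)
subsets zero    = [ [] ]
subsets (suc n) = map (outside ∷_) (subsets n) ++ map (inside ∷_) (subsets n)

module _ {n : ℕ} (G : SimpleGraph n) where
  open SimpleGraph G

  Independent : Subset n → Set
  Independent S = S ⊆ vertices × (∀ a b → a ∈ S → b ∈ S → ¬ (a ~ b))

  independent? : ∀ S → Dec (Independent S)
  independent? S = (S ⊆? vertices) ×-dec
    all? λ a → all? λ b → (a ∈? S) →-dec ((b ∈? S) →-dec ¬? (a ~? b))

  independentSets : List (Subset n)
  independentSets = filter independent? (subsets n)

  α : ℕ
  α = max 0 (map ∣_∣ independentSets)

  s : ℕ → ℕ
  s k = length (filter (λ S → ∣ S ∣ ℕ.≟ k) independentSets)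

  I : ℂ → ℂ
  I x = sumᶜ {suc α} λ k → s (toℕ k) ×ᶜ (x ^ᶜ toℕ k)

------------------------------------------------------------------------
-- The zero divisor graph of ℤ/n, with Fin n as the ring of residues

IsZero : ∀ {n} → Fin n → Set
IsZero a = toℕ a ≡ 0

infixl 7 _·_

-- An element of Fin n witnesses n ≠ 0, so Γ is total, with Γ 0 empty.
_·_ : ∀ {n} → Fin n → Fin n → Fin n
_·_ {n} a b = ((toℕ a ℕ.* toℕ b) mod n) {{nonZeroIndex a}}

NonzeroZeroDivisor : ∀ {n} → Fin n → Set
NonzeroZeroDivisor a = ¬ IsZero a × ∃ λ b → ¬ IsZero b × IsZero (a · b)

isZero? : ∀ {n} (a : Fin n) → Dec (IsZero a)
isZero? a = toℕ a ℕ.≟ 0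

nonzeroZeroDivisor? : ∀ {n} (a : Fin n) → Dec (NonzeroZeroDivisor a)
nonzeroZeroDivisor? a = ¬? (isZero? a) ×-dec any? λ b → ¬? (isZero? b) ×-dec isZero? (a · b)

nonzeroZeroDivisors : ∀ n → Subset n
nonzeroZeroDivisors n = Vec.tabulate (does ∘ nonzeroZeroDivisor?)

Γ : ∀ n → SimpleGraph n
Γ n = record
  { vertices = V
  ; _~_      = λ a b → a ∈ V × b ∈ V × a ≢ b × IsZero (a · b)
  ; _~?_     = λ a b → (a ∈? V) ×-dec (b ∈? V) ×-dec ¬? (a Fin.≟ b) ×-dec isZero? (a · b)
  ; ~⇒∈      = proj₁
  ; ~-sym    = λ {a} {b} (a∈V , b∈V , a≢b , ab≡0) →
      b∈V , a∈V , (λ b≡a → a≢b (sym b≡a)) , trans (cong toℕ (·-comm b a)) ab≡0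
  ; ~-irrefl = λ { refl (_ , _ , a≢a , _) → a≢a refl }
  }
  where
  V = nonzeroZeroDivisors n
  ·-comm : ∀ (a b : Fin n) → a · b ≡ b · a
  ·-comm a b = cong (λ m → (m mod n) {{nonZeroIndex a}}) (ℕ.*-comm (toℕ a) (toℕ b))

------------------------------------------------------------------------
-- The radii

R : (p q : ℕ) → p ℕ.< q → ℝ
R p q p<q = root (q ℕ.∸ p) {{ℕ.>-nonZero (ℕ.m<n⇒0<n∸m p<q)}} 2ᴿ

denominator : (p q : ℕ) → p ℕ.< q → ℝ
denominator p q p<q = R p q p<q ^ᴿ (q ℕ.∸ 1) +ᴿ R p q p<q ^ᴿ (p ℕ.∸ 1) -ᴿ 2ᴿ

module PositivityLemmas where
  -- (1 + e)ᵏ ≤ 1 + (2ᵏ - 1) e for 0 ≤ e ≤ 1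
  T : ℕ → ℚ
  T zero    = 0ℚ
  T (suc k) = 1ℚ + (T k + T k)

  0≤T : ∀ k → 0ℚ ≤ T k
  0≤T zero    = ℚ.≤-refl
  0≤T (suc k) = ℚ.+-mono-≤ (ℚ.<⇒≤ 0<1) (ℚ.+-mono-≤ (0≤T k) (0≤T k))

  ^-chord : ∀ k {e} → 0ℚ ≤ e → e ≤ 1ℚ → (1ℚ + e) ^ℚ k ≤ 1ℚ + T k * e
  ^-chord zero    {e} 0≤e e≤1 = ℚ.≤-reflexive
    (solve 1 (λ x → con 1ℚ := con 1ℚ :+ con 0ℚ :* x) refl e)
  ^-chord (suc k) {e} 0≤e e≤1 = ℚ.≤-trans
    (ℚ.*-monoˡ-≤-nonNeg (1ℚ + e)
      {{ℚ.nonNegative (ℚ.+-mono-≤ (ℚ.<⇒≤ 0<1) 0≤e)}} (^-chord k 0≤e e≤1))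
    (subst₂ _≤_
      (solve 2 (λ t x → (con 1ℚ :+ x :+ t :* x) :+ (t :* x) :* x
                     := (con 1ℚ :+ x) :* (con 1ℚ :+ t :* x)) refl (T k) e)
      (solve 2 (λ t x → (con 1ℚ :+ x :+ t :* x) :+ (t :* x) :* con 1ℚ
                     := con 1ℚ :+ (con 1ℚ :+ (t :+ t)) :* x) refl (T k) e)
      (ℚ.+-monoʳ-≤ (1ℚ + e + T k * e)
        (ℚ.*-monoˡ-≤-nonNeg (T k * e) {{ℚ.nonNegative (0≤* (0≤T k) 0≤e)}} e≤1)))

  -- a rational above 1 whose k-th power is at most 2
  module _ (k : ℕ) where
    private
      0<1+T : 0ℚ < 1ℚ + T k
      0<1+T = ℚ.+-mono-<-≤ 0<1 (0≤T k)

    gap : ℚ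
    gap = invℚ (1ℚ + T k)

    0<gap : 0ℚ < gap
    0<gap = invℚ-pos 0<1+T

    gap+Tgap : gap + T k * gap ≡ 1ℚ
    gap+Tgap = trans
      (solve 2 (λ g t → g :+ t :* g := g :* (con 1ℚ :+ t)) refl gap (T k))
      (invℚ-inverse 0<1+T)

    gap-power : (1ℚ + gap) ^ℚ k ≤ 1ℚ + 1ℚ
    gap-power = ℚ.≤-trans
      (^-chord k (ℚ.<⇒≤ 0<gap)
        (subst₂ _≤_ (ℚ.+-identityʳ gap) gap+Tgap
          (ℚ.+-monoʳ-≤ gap (0≤* (0≤T k) (ℚ.<⇒≤ 0<gap)))))
      (ℚ.+-monoʳ-≤ 1ℚ
        (subst₂ _≤_ (ℚ.+-identityˡ (T k * gap)) gap+Tgap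
          (ℚ.+-monoˡ-≤ (T k * gap) (ℚ.<⇒≤ 0<gap))))

  1<root2 : ∀ k .{{_ : NonZero k}} → 1ᴿ <ᴿ root k 2ᴿ
  1<root2 k with archimedean (half-pos (0<gap k))
  ... | N , δ≤ = ½ * gap k , half-pos (0<gap k) , N , λ n N≤n →
    let b = rootℚ k (1ℚ + 1ℚ) n
        h = ½ * gap k
        1+gap<b+h : 1ℚ + gap k < b + h
        1+gap<b+h = ℚ.<-≤-trans
          (^-cancel-< k
            (ℚ.+-mono-≤ (rootℚ-nonNeg k (1ℚ + 1ℚ) n) (ℚ.<⇒≤ (0<1/suc n)))
            (ℚ.≤-<-trans (gap-power k) (rootℚ-upper k (1ℚ + 1ℚ) n)))
          (ℚ.+-monoʳ-≤ b (δ≤ n N≤n))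
    in subst₂ _<_
      (solve 1 (λ g → (con 1ℚ :+ g) :- con ½ :* g := con 1ℚ :+ con ½ :* g) refl (gap k))
      (solve 2 (λ x y → (x :+ y) :- y := x) refl b h)
      (ℚ.+-monoˡ-< (- h) 1+gap<b+h)

  seq-^ : ∀ x k n → seq (x ^ᴿ k) n ≡ seq x n ^ℚ k
  seq-^ x zero    n = refl
  seq-^ x (suc k) n = cong (seq x n *_) (seq-^ x k n)

  1<x⇒0<xʲ+xᵏ-2 : ∀ {x} → 1ᴿ <ᴿ x → ∀ j k .{{_ : NonZero j}} .{{_ : NonZero k}} →
                  0ᴿ <ᴿ x ^ᴿ j +ᴿ x ^ᴿ k -ᴿ 2ᴿ
  1<x⇒0<xʲ+xᵏ-2 {x} (ε , 0<ε , N , h) j k = ε , 0<ε , N , λ n N≤n →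
    let a = seq x n
        1≤a = ℚ.≤-trans
          (subst (_≤ 1ℚ + ε) (ℚ.+-identityʳ 1ℚ) (ℚ.+-monoʳ-≤ 1ℚ (ℚ.<⇒≤ 0<ε)))
          (ℚ.<⇒≤ (h n N≤n))
        1+ε<aʲ = ℚ.<-≤-trans (h n N≤n) (≤^ j 1≤a)
        1≤aᵏ = 1≤^ k 1≤a
    in subst₂ _<_
      (solve 1 (λ e → ((con 1ℚ :+ e) :+ con 1ℚ) :- (con 1ℚ :+ con 1ℚ) := con 0ℚ :+ e) refl ε)
      (sym (cong₂ (λ u v → u + v - (1ℚ + 1ℚ)) (seq-^ x j n) (seq-^ x k n)))
      (ℚ.+-monoˡ-< (- (1ℚ + 1ℚ)) (ℚ.+-mono-<-≤ 1+ε<aʲ 1≤aᵏ))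

  2≤⇒nonZero-∸1 : ∀ {n} → 2 ℕ.≤ n → NonZero (n ℕ.∸ 1)
  2≤⇒nonZero-∸1 2≤n = ℕ.>-nonZero (ℕ.∸-monoˡ-≤ 1 2≤n)

open PositivityLemmas

0<denominator : ∀ {p} q → Prime p → (p<q : p ℕ.< q) → 0ᴿ <ᴿ denominator p q p<q
0<denominator {p} q p-prime p<q =
  1<x⇒0<xʲ+xᵏ-2 (1<root2 (q ℕ.∸ p) {{ℕ.>-nonZero (ℕ.m<n⇒0<n∸m p<q)}})
    (q ℕ.∸ 1) (p ℕ.∸ 1)
    {{2≤⇒nonZero-∸1 (ℕ.≤-trans 2≤p (ℕ.<⇒≤ p<q))}} {{2≤⇒nonZero-∸1 2≤p}}
  where
  2≤p : 2 ℕ.≤ p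
  2≤p = ℕ.nonTrivial⇒n>1 p {{prime⇒nonTrivial p-prime}}

-- Primality of p is used only for 2 ≤ p, which makes the denominator positive.
r₁ : (p q : ℕ) → Prime p → p ℕ.< q → ℝ
r₁ p q p-prime p<q =
  (R p q p<q -ᴿ 1ᴿ) /ᴿ denominator p q p<q ⟨ 0<denominator q p-prime p<q ⟩

r₂ : (p q : ℕ) → p ℕ.< q → ℝ
r₂ p q p<q = R p q p<q +ᴿ 1ᴿ

{-# OPTIONS --safe #-}
module Submission where

-- Γ(ℤ/pq) is the complete bipartite graph on the q - 1 nonzero multiples of p and the
-- p - 1 nonzero multiples of q, so with a = p - 1 and b = q - 1 its independence
-- polynomial is (1 + x)ᵇ + (1 + x)ᵃ - 1.  If ∣1 + x∣ ≥ R, then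
-- ∣(1 + x)ᵃ ((1 + x)ᵇ⁻ᵃ + 1)∣ ≥ Rᵃ (2 - 1) > 1, so x is not a zero.  A zero also satisfies
-- 1 ≤ (1 + ∣x∣)ᵇ + (1 + ∣x∣)ᵃ - 2, and the right side is convex in ∣x∣, vanishes at 0 and
-- equals Rᵇ + Rᵃ - 2 > 1 at ∣x∣ = R - 1, so it is below 1 up to ∣x∣ = r₁.
-- To obtain strict inequalities between Cauchy sequences, R is replaced by a rational
-- c < R with cᵇ > cᵃ + 1, for which both arguments still work, and they are applied to
-- the terms of the sequences, which are approximate zeros.

open import Defs
open import Algebra.Bundles using (CommutativeRing; CommutativeSemiring)
import Algebra.Definitions.RawSemiring as RawSemiringDefs
import Algebra.Properties.CommutativeSemigroup as CommutativeSemigroupProperties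
import Algebra.Properties.CommutativeSemiring.Exp as CommutativeExp
import Algebra.Properties.Semiring.Exp as Exp
import Algebra.Properties.Semiring.Sum as SemiringSum
import Algebra.Solver.Ring.AlmostCommutativeRing as ACR
import Algebra.Solver.Ring.Simple as RingSolver
open import Data.Bool.Base using (Bool; true; false; if_then_else_; not; _∧_)
open import Data.Empty using (⊥-elim)
open import Data.Fin.Base using (Fin; zero; suc; toℕ; fromℕ<)
open import Data.Fin.Properties using (any?; toℕ<n; toℕ-fromℕ<)
open import Data.Fin.Subset using (Subset; inside; outside; _∈_; _⊆_; ∣_∣; ⊥)
open import Data.Fin.Subset.Properties using (_∈?_; _⊆?_; ∉⊥; ∣⊥∣≡0)
open import Data.List.Base using (List; []; _∷_; _++_; map; filter; length)
open import Data.List.Extrema.Nat using (xs≤max)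
open import Data.List.Properties using (filter-≐)
open import Data.List.Relation.Unary.All as All using (All; []; _∷_)
import Data.List.Relation.Unary.All.Properties as All
open import Data.Nat.Base as ℕ using (ℕ; zero; suc; s≤s; NonZero)
open import Data.Nat.Coprimality using (prime⇒coprime; coprime-divisor)
open import Data.Nat.DivMod using (_%_)
open import Data.Nat.Divisibility
open import Data.Nat.Primality using (Prime; euclidsLemma; prime⇒nonZero; prime⇒nonTrivial)
import Data.Nat.Properties as ℕ
open import Data.Product.Base using (_×_; _,_; proj₁; proj₂; ∃; map₂)
import Data.Rational.Base as ℚ
import Data.Rational.Properties as ℚ
open import Data.Rational.Solver using (module +-*-Solver)
open import Data.Sum.Base using (_⊎_; inj₁; inj₂)
open import Data.Vec.Base using (tabulate; []; _∷_)
open import Data.Vec.Properties using (lookup∘tabulate; []=⇒lookup; lookup⇒[]=)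
open import Function.Base using (_∘_; id)
open import Function.Bundles using (mk⇔)
open import Level using (0ℓ)
open import Relation.Binary.PropositionalEquality
  using (_≡_; refl; sym; trans; cong; cong₂; subst; subst₂; _≗_; isEquivalence)
open import Relation.Nullary using (¬_; Dec; yes; no; does; contradiction)
open import Relation.Nullary.Decidable
  using (¬?; _×-dec_; _⊎-dec_; dec-true; dec-false; decidable-stable; does-⇔; map′)

-- The independence polynomial as a sum over independent sets

module IndependencePolynomial {c ℓ} (C : CommutativeSemiring c ℓ) where
  open CommutativeSemiring C
    renaming (_+_ to _⊕_; _*_ to _⊗_; refl to ≈-refl; sym to ≈-sym; trans to ≈-trans)
    hiding (zero)
  open RawSemiringDefs rawSemiring
    using (_^_; sum) renaming (_×_ to _×′_)
  open SemiringSum semiring using (sum-cong-≋; ∑-distrib-+; sum-replicate-zero)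
  open CommutativeSemigroupProperties +-commutativeSemigroup using (interchange)
  open import Relation.Binary.Reasoning.Setoid setoid

  private variable
    A B : Set

  infix 8 _when_
  _when_ : Carrier → Bool → Carrier
  x when b = if b then x else 0#

  ∑ : (A → Carrier) → List A → Carrier
  ∑ f []       = 0#
  ∑ f (a ∷ as) = f a ⊕ ∑ f as

  ∑-cong : ∀ {f g : A → Carrier} → (∀ a → f a ≈ g a) → ∀ as → ∑ f as ≈ ∑ g as
  ∑-cong f≈g []       = ≈-refl
  ∑-cong f≈g (a ∷ as) = +-cong (f≈g a) (∑-cong f≈g as)

  ∑-zero : (as : List A) → ∑ (λ _ → 0#) as ≈ 0#
  ∑-zero []       = ≈-refl
  ∑-zero (a ∷ as) = ≈-trans (+-identityˡ _) (∑-zero as)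

  ∑-⊕ : ∀ (f g : A → Carrier) as → ∑ (λ a → f a ⊕ g a) as ≈ ∑ f as ⊕ ∑ g as
  ∑-⊕ f g []       = ≈-sym (+-identityˡ 0#)
  ∑-⊕ f g (a ∷ as) = ≈-trans (+-congˡ (∑-⊕ f g as)) (interchange _ _ _ _)

  ∑-⊗ : ∀ x (f : A → Carrier) as → ∑ (λ a → x ⊗ f a) as ≈ x ⊗ ∑ f as
  ∑-⊗ x f []       = ≈-sym (zeroʳ x)
  ∑-⊗ x f (a ∷ as) = ≈-trans (+-congˡ (∑-⊗ x f as)) (≈-sym (distribˡ x _ _))

  ∑-++ : ∀ (f : A → Carrier) as bs → ∑ f (as ++ bs) ≈ ∑ f as ⊕ ∑ f bs
  ∑-++ f []       bs = ≈-sym (+-identityˡ _)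
  ∑-++ f (a ∷ as) bs = ≈-trans (+-congˡ (∑-++ f as bs)) (≈-sym (+-assoc _ _ _))

  ∑-map : ∀ (f : B → Carrier) (g : A → B) as → ∑ f (map g as) ≡ ∑ (f ∘ g) as
  ∑-map f g []       = refl
  ∑-map f g (a ∷ as) = cong (f (g a) ⊕_) (∑-map f g as)

  ∑-filter : ∀ {P : A → Set} (P? : ∀ a → Dec (P a)) f as →
             ∑ f (filter P? as) ≈ ∑ (λ a → f a when does (P? a)) as
  ∑-filter P? f [] = ≈-refl
  ∑-filter P? f (a ∷ as) with does (P? a)
  ... | false = ≈-trans (∑-filter P? f as) (≈-sym (+-identityˡ _))
  ... | true  = +-congˡ (∑-filter P? f as)

  sum-when-≟ : ∀ (f : ℕ → Carrier) m n → m ℕ.< n →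
               sum {n} (λ k → f (toℕ k) when does (m ℕ.≟ toℕ k)) ≈ f m
  sum-when-≟ f zero    (suc n) (s≤s _)   =
    ≈-trans (+-congˡ (sum-replicate-zero n)) (+-identityʳ (f 0))
  sum-when-≟ f (suc m) (suc n) (s≤s m<n) =
    ≈-trans (+-identityˡ _) (sum-when-≟ (f ∘ suc) m n m<n)

  -- Prepending `a` raises exactly one count by one, the count at `w a`; the bound on the weights
  -- puts this index within the range of the outer sum.
  ∑-by-weight : ∀ (w : A → ℕ) n x as → All (λ a → w a ℕ.< n) as →
    sum {n} (λ k → length (filter (λ a → w a ℕ.≟ toℕ k) as) ×′ (x ^ toℕ k)) ≈
    ∑ (λ a → x ^ w a) as
  ∑-by-weight w n x []       []           = sum-replicate-zero n
  ∑-by-weight w n x (a ∷ as) (wa<n ∷ was<n) = begin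
    sum {n} (λ k → length (filter (λ b → w b ℕ.≟ toℕ k) (a ∷ as)) ×′ (x ^ toℕ k))
      ≈⟨ sum-cong-≋ {n} (λ k → step (toℕ k)) ⟩
    sum {n} (λ k → (x ^ toℕ k) when does (w a ℕ.≟ toℕ k) ⊕ number (toℕ k) ×′ (x ^ toℕ k))
      ≈⟨ ∑-distrib-+ {n} (λ k → (x ^ toℕ k) when does (w a ℕ.≟ toℕ k))
           (λ k → number (toℕ k) ×′ (x ^ toℕ k)) ⟩
    sum {n} (λ k → (x ^ toℕ k) when does (w a ℕ.≟ toℕ k)) ⊕
    sum {n} (λ k → number (toℕ k) ×′ (x ^ toℕ k))
      ≈⟨ +-cong (sum-when-≟ (x ^_) (w a) n wa<n) (∑-by-weight w n x as was<n) ⟩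
    x ^ w a ⊕ ∑ (λ b → x ^ w b) as
      ∎
    where
    number : ℕ → ℕ
    number k = length (filter (λ b → w b ℕ.≟ k) as)
    step : ∀ k → length (filter (λ b → w b ℕ.≟ k) (a ∷ as)) ×′ (x ^ k) ≈
                 (x ^ k) when does (w a ℕ.≟ k) ⊕ number k ×′ (x ^ k)
    step k with does (w a ℕ.≟ k)
    ... | false = ≈-sym (+-identityˡ _)
    ... | true  = ≈-refl

  -- The binomial theorem without binomial coefficients: at each `inside` entry of `A` a subset may
  -- omit or take the element, giving a factor `1 + x`, and an `outside` entry gives the factor 1.
  ∑-⊆ : ∀ x {n} (A : Subset n) →
        ∑ (λ S → (x ^ ∣ S ∣) when does (S ⊆? A)) (subsets n) ≈ (1# ⊕ x) ^ ∣ A ∣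
  ∑-⊆ x [] = +-identityʳ 1#
  ∑-⊆ x {suc n} (a ∷ A) = begin
    ∑ f (map (outside ∷_) (subsets n) ++ map (inside ∷_) (subsets n))
      ≈⟨ ∑-++ f (map (outside ∷_) (subsets n)) _ ⟩
    ∑ f (map (outside ∷_) (subsets n)) ⊕ ∑ f (map (inside ∷_) (subsets n))
      ≡⟨ cong₂ _⊕_ (∑-map f (outside ∷_) (subsets n)) (∑-map f (inside ∷_) (subsets n)) ⟩
    ∑ (f ∘ (outside ∷_)) (subsets n) ⊕ ∑ (f ∘ (inside ∷_)) (subsets n)
      ≈⟨ +-congʳ (∑-⊆ x A) ⟩
    (1# ⊕ x) ^ ∣ A ∣ ⊕ ∑ (f ∘ (inside ∷_)) (subsets n)
      ≈⟨ insideSum a ⟩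
    (1# ⊕ x) ^ ∣ a ∷ A ∣
      ∎
    where
    f : Subset (suc n) → Carrier
    f S = (x ^ ∣ S ∣) when does (S ⊆? (a ∷ A))
    pull : ∀ y b → (x ⊗ y) when b ≈ x ⊗ y when b
    pull y true  = ≈-refl
    pull y false = ≈-sym (zeroʳ x)
    insideSum : ∀ a → (1# ⊕ x) ^ ∣ A ∣ ⊕
      ∑ (λ S → (x ^ ∣ inside ∷ S ∣) when does ((inside ∷ S) ⊆? (a ∷ A))) (subsets n) ≈
      (1# ⊕ x) ^ ∣ a ∷ A ∣
    -- `(inside ∷ S) ⊆? (outside ∷ A)` computes to a negative answer, so every term is already `0#`.
    insideSum outside = ≈-trans (+-congˡ (∑-zero (subsets n))) (+-identityʳ _)
    insideSum inside  = begin
      y ⊕ ∑ (λ S → (x ⊗ x ^ ∣ S ∣) when does (S ⊆? A)) (subsets n)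
        ≈⟨ +-congˡ (∑-cong (λ S → pull (x ^ ∣ S ∣) (does (S ⊆? A))) (subsets n)) ⟩
      y ⊕ ∑ (λ S → x ⊗ (x ^ ∣ S ∣) when does (S ⊆? A)) (subsets n)
        ≈⟨ +-congˡ (≈-trans (∑-⊗ x _ (subsets n)) (*-congˡ (∑-⊆ x A))) ⟩
      y ⊕ x ⊗ y
        ≈⟨ +-congʳ (*-identityˡ y) ⟨
      1# ⊗ y ⊕ x ⊗ y
        ≈⟨ distribʳ y 1# x ⟨
      (1# ⊕ x) ⊗ y
        ∎
      where y = (1# ⊕ x) ^ ∣ A ∣

  -- Put additively because a semiring has no subtraction; it holds term by term.
  inclusion-exclusion : ∀ {U V : A → Set} (U? : ∀ a → Dec (U a)) (V? : ∀ a → Dec (V a))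
    (f : A → Carrier) as →
    ∑ (λ a → f a when does (U? a ⊎-dec V? a)) as ⊕ ∑ (λ a → f a when does (U? a ×-dec V? a)) as ≈
    ∑ (λ a → f a when does (U? a)) as ⊕ ∑ (λ a → f a when does (V? a)) as
  inclusion-exclusion U? V? f as = begin
    ∑ (λ a → f a when does (U? a ⊎-dec V? a)) as ⊕ ∑ (λ a → f a when does (U? a ×-dec V? a)) as
      ≈⟨ ∑-⊕ _ _ as ⟨
    ∑ (λ a → f a when does (U? a ⊎-dec V? a) ⊕ f a when does (U? a ×-dec V? a)) as
      ≈⟨ ∑-cong pointwise as ⟩
    ∑ (λ a → f a when does (U? a) ⊕ f a when does (V? a)) as
      ≈⟨ ∑-⊕ _ _ as ⟩
    ∑ (λ a → f a when does (U? a)) as ⊕ ∑ (λ a → f a when does (V? a)) as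
      ∎
    where
    pointwise : ∀ a → f a when does (U? a ⊎-dec V? a) ⊕ f a when does (U? a ×-dec V? a) ≈
                      f a when does (U? a) ⊕ f a when does (V? a)
    pointwise a with does (U? a) | does (V? a)
    ... | true  | true  = ≈-refl
    ... | true  | false = ≈-refl
    ... | false | true  = +-comm (f a) 0#
    ... | false | false = ≈-refl

  module _ {n} (G : SimpleGraph n) where

    -- The defining sum of `I` over any commutative semiring, so that it can also be evaluated at
    -- the Gaussian rationals that occur as terms of a complex number.
    evalI : Carrier → Carrier
    evalI x = sum {suc (α G)} λ k → s G (toℕ k) ×′ (x ^ toℕ k)

    evalI-∑ : ∀ x → evalI x ≈ ∑ (λ S → x ^ ∣ S ∣) (independentSets G)
    evalI-∑ x = ∑-by-weight ∣_∣ (suc (α G)) x (independentSets G)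
      (All.map s≤s (All.map⁻ (xs≤max 0 (map ∣_∣ (independentSets G)))))

    -- Inclusion-exclusion for the subsets of `A` and those of `B`: by disjointness only the empty
    -- set is of both kinds, and it accounts for the summand `1#`.
    evalI-two-parts : ∀ (A B : Subset n) →
      (∀ S → Independent G S → S ⊆ A ⊎ S ⊆ B) →
      (∀ S → S ⊆ A ⊎ S ⊆ B → Independent G S) →
      (∀ {a} → a ∈ A → ¬ a ∈ B) →
      ∀ x → evalI x ⊕ 1# ≈ (1# ⊕ x) ^ ∣ A ∣ ⊕ (1# ⊕ x) ^ ∣ B ∣
    evalI-two-parts A B ind⇒ ind⇐ disjoint x = begin
      evalI x ⊕ 1#
        -- Writing `1#` as a power with exponent `∣ ⊥ ∣` turns it into the sum over the subsets of
        -- `⊥`, which are the sets contained in both parts.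
        ≈⟨ +-cong (evalI-∑ x) (reflexive (cong ((1# ⊕ x) ^_) (sym (∣⊥∣≡0 n)))) ⟩
      ∑ f (independentSets G) ⊕ (1# ⊕ x) ^ ∣ ⊥ {n} ∣
        ≈⟨ +-cong
             (≈-trans (reflexive (cong (∑ f) (filter-≐ (independent? G) A∪B?
                ((λ {S} → ind⇒ S) , (λ {S} → ind⇐ S)) (subsets n))))
               (∑-filter A∪B? f (subsets n)))
             (≈-trans (≈-sym (∑-⊆ x (⊥ {n})))
               (≈-trans (≈-sym (∑-filter (_⊆? ⊥) f (subsets n)))
                 (≈-trans (reflexive (cong (∑ f) (filter-≐ (_⊆? ⊥) A∩B?
                    ((λ S⊆⊥ → (λ {_} a∈S → ⊥-elim (∉⊥ (S⊆⊥ a∈S))) , λ {_} a∈S → ⊥-elim (∉⊥ (S⊆⊥ a∈S)))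
                    , λ (S⊆A , S⊆B) a∈S → ⊥-elim (disjoint (S⊆A a∈S) (S⊆B a∈S)))
                    (subsets n))))
                   (∑-filter A∩B? f (subsets n))))) ⟩
      ∑ (λ S → f S when does (A∪B? S)) (subsets n) ⊕ ∑ (λ S → f S when does (A∩B? S)) (subsets n)
        ≈⟨ inclusion-exclusion (_⊆? A) (_⊆? B) f (subsets n) ⟩
      ∑ (λ S → f S when does (S ⊆? A)) (subsets n) ⊕ ∑ (λ S → f S when does (S ⊆? B)) (subsets n)
        ≈⟨ +-cong (∑-⊆ x A) (∑-⊆ x B) ⟩
      (1# ⊕ x) ^ ∣ A ∣ ⊕ (1# ⊕ x) ^ ∣ B ∣
        ∎
      where
      f : Subset n → Carrier
      f S = x ^ ∣ S ∣
      A∪B? : ∀ S → Dec (S ⊆ A ⊎ S ⊆ B)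
      A∪B? S = S ⊆? A ⊎-dec S ⊆? B
      A∩B? : ∀ S → Dec (S ⊆ A × S ⊆ B)
      A∩B? S = S ⊆? A ×-dec S ⊆? B

-- Subsets of Fin n given by decidable predicates

module _ {n} {P : Fin n → Set} (P? : ∀ a → Dec (P a)) where

  ∈-tabulate⁺ : ∀ {a} → P a → a ∈ tabulate (does ∘ P?)
  ∈-tabulate⁺ {a} pa =
    lookup⇒[]= a _ (trans (lookup∘tabulate (does ∘ P?) a) (dec-true (P? a) pa))

  ∈-tabulate⁻ : ∀ {a} → a ∈ tabulate (does ∘ P?) → P a
  ∈-tabulate⁻ {a} a∈ with P? a | trans (sym (lookup∘tabulate (does ∘ P?) a)) ([]=⇒lookup a∈)
  ... | yes pa | _ = pa
  ... | no _   | ()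

-- Predicates on `ℕ` rather than on `Fin n` can be shifted, which allows cutting an interval into
-- blocks.
count : (ℕ → Bool) → ℕ → ℕ
count f zero    = 0
count f (suc n) = (if f 0 then suc else id) (count (f ∘ suc) n)

∣tabulate∣ : ∀ f n → ∣ tabulate {n = n} (f ∘ toℕ) ∣ ≡ count f n
∣tabulate∣ f zero = refl
∣tabulate∣ f (suc n) with f 0
... | true  = cong suc (∣tabulate∣ (f ∘ suc) n)
... | false = ∣tabulate∣ (f ∘ suc) n

count-cong : ∀ {f g} → f ≗ g → ∀ n → count f n ≡ count g n
count-cong f≗g zero    = refl
count-cong f≗g (suc n) =
  cong₂ (λ b → if b then suc else id) (f≗g 0) (count-cong (f≗g ∘ suc) n)

count-+ : ∀ f m n → count f (m ℕ.+ n) ≡ count f m ℕ.+ count (f ∘ (m ℕ.+_)) n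
count-+ f zero    n = refl
count-+ f (suc m) n with f 0
... | true  = cong suc (count-+ (f ∘ suc) m n)
... | false = count-+ (f ∘ suc) m n

count-none : ∀ f n → (∀ {i} → i ℕ.< n → f i ≡ false) → count f n ≡ 0
count-none f zero    none = refl
count-none f (suc n) none rewrite none {0} (s≤s ℕ.z≤n) =
  count-none (f ∘ suc) n (λ i<n → none (s≤s i<n))

-- Divisibility by `m` has period `m`, and in each block of length `m` only the first entry is a
-- multiple.
count-multiples : ∀ m .{{_ : NonZero m}} k → count (λ i → does (m ∣? i)) (k ℕ.* m) ≡ k
count-multiples m       zero    = refl
count-multiples m@(suc l) (suc k) = trans (count-+ f m (k ℕ.* m))
  (cong₂ ℕ._+_ one
    (trans (count-cong periodic (k ℕ.* m)) (count-multiples m k)))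
  where
  f : ℕ → Bool
  f i = does (m ∣? i)
  periodic : f ∘ (m ℕ.+_) ≗ f
  periodic i = does-⇔ (mk⇔ (λ m∣m+i → ∣m+n∣m⇒∣n m∣m+i ∣-refl) (∣m∣n⇒∣m+n ∣-refl)) (m ∣? m ℕ.+ i) (m ∣? i)
  one : count f m ≡ 1
  one rewrite dec-true (m ∣? 0) (m ∣0) = cong suc (count-none (f ∘ suc) l
    λ i<l → dec-false (m ∣? _) (>⇒∤ (s≤s i<l)))

-- The zero divisor graph of ℤ/pq

NonzeroMultiple : ∀ {n} → ℕ → Fin n → Set
NonzeroMultiple m a = ¬ IsZero a × m ∣ toℕ a

nonzeroMultiple? : ∀ {n} m (a : Fin n) → Dec (NonzeroMultiple m a)
nonzeroMultiple? m a = ¬? (isZero? a) ×-dec m ∣? toℕ a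

nonzeroMultiples : ∀ n → ℕ → Subset n
nonzeroMultiples n m = tabulate (does ∘ nonzeroMultiple? m)

∣nonzeroMultiples∣ : ∀ m .{{_ : NonZero m}} k → ∣ nonzeroMultiples (k ℕ.* m) m ∣ ≡ k ℕ.∸ 1
∣nonzeroMultiples∣ m         zero    = refl
∣nonzeroMultiples∣ m@(suc l) (suc k) = ℕ.suc-injective (trans punctured (count-multiples m (suc k)))
  where
  g : ℕ → Bool
  g i = not (does (i ℕ.≟ 0)) ∧ does (m ∣? i)
  -- The two predicates differ only at 0, which `m` divides; beyond it they agree by computation.
  punctured : suc ∣ nonzeroMultiples (suc k ℕ.* m) m ∣ ≡ count (λ i → does (m ∣? i)) (suc k ℕ.* m)
  punctured rewrite ∣tabulate∣ g (suc k ℕ.* m) | dec-true (m ∣? 0) (m ∣0) = refl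

1<-prime : ∀ {p} → Prime p → 1 ℕ.< p
1<-prime {p} p-prime = ℕ.nonTrivial⇒n>1 p {{prime⇒nonTrivial p-prime}}

module _ {p q} (p-prime : Prime p) (q-prime : Prime q) (p<q : p ℕ.< q) where
  private
    n = p ℕ.* q
    A = nonzeroMultiples n p
    B = nonzeroMultiples n q
    instance
      p≢0 : NonZero p
      p≢0 = prime⇒nonZero p-prime
      q≢0 : NonZero q
      q≢0 = prime⇒nonZero q-prime
      n≢0 : NonZero n
      n≢0 = ℕ.m*n≢0 p q

  pq∣⇒zero : ∀ {m} → m ℕ.< n → n ∣ m → m ≡ 0
  pq∣⇒zero {zero}  m<n n∣m = refl
  pq∣⇒zero {suc m} m<n n∣m = contradiction m<n (ℕ.≤⇒≯ (∣⇒≤ n∣m))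

  -- The number is `k * p` for some `k`, and the prime `q`, being coprime to the smaller `p`,
  -- divides `k`.
  p∣q∣⇒pq∣ : ∀ {m} → p ∣ m → q ∣ m → n ∣ m
  p∣q∣⇒pq∣ (divides k refl) q∣kp = subst (n ∣_) (ℕ.*-comm p k) (*-monoʳ-∣ p
    (coprime-divisor (prime⇒coprime q-prime p<q) (subst (q ∣_) (ℕ.*-comm k p) q∣kp)))

  p∣q∣⇒isZero : ∀ (a : Fin n) → p ∣ toℕ a → q ∣ toℕ a → IsZero a
  p∣q∣⇒isZero a p∣a q∣a = pq∣⇒zero (toℕ<n a) (p∣q∣⇒pq∣ p∣a q∣a)

  toℕ-· : ∀ (a b : Fin n) → toℕ (a · b) ≡ (toℕ a ℕ.* toℕ b) % n
  toℕ-· a b = toℕ-fromℕ< _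

  ·-isZero⁺ : ∀ (a b : Fin n) → n ∣ toℕ a ℕ.* toℕ b → IsZero (a · b)
  ·-isZero⁺ a b n∣ab = trans (toℕ-· a b) (n∣m⇒m%n≡0 _ n n∣ab)

  ·-isZero⁻ : ∀ (a b : Fin n) → IsZero (a · b) → n ∣ toℕ a ℕ.* toℕ b
  ·-isZero⁻ a b ab≡0 = m%n≡0⇒n∣m _ n (trans (sym (toℕ-· a b)) ab≡0)

  ∣ˡ∣ʳ⇒·-isZero : ∀ {a b : Fin n} → p ∣ toℕ a → q ∣ toℕ b → IsZero (a · b)
  ∣ˡ∣ʳ⇒·-isZero {a} {b} p∣a q∣b =
    ·-isZero⁺ a b (∣-trans (*-monoˡ-∣ q p∣a) (*-monoʳ-∣ (toℕ a) q∣b))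

  ·-isZero⇒∣ : ∀ {m} → Prime m → m ∣ n → ∀ (a b : Fin n) → IsZero (a · b) → (m ∣ toℕ a) ⊎ (m ∣ toℕ b)
  ·-isZero⇒∣ m-prime m∣n a b ab≡0 =
    euclidsLemma (toℕ a) (toℕ b) m-prime (∣-trans m∣n (·-isZero⁻ a b ab≡0))

  p∣n : p ∣ n
  p∣n = m∣m*n q

  q∣n : q ∣ n
  q∣n = n∣m*n p

  -- Each of `p` and `q` divides `a` or its annihilator `b`; they cannot both divide `b`, as `b`
  -- would then be zero.
  vertex⇒ : ∀ {a : Fin n} → NonzeroZeroDivisor a → a ∈ A ⊎ a ∈ B
  vertex⇒ {a} (a≢0 , b , b≢0 , ab≡0)
    with ·-isZero⇒∣ p-prime p∣n a b ab≡0 | ·-isZero⇒∣ q-prime q∣n a b ab≡0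
  ... | inj₁ p∣a | _        = inj₁ (∈-tabulate⁺ (nonzeroMultiple? p) (a≢0 , p∣a))
  ... | inj₂ _   | inj₁ q∣a = inj₂ (∈-tabulate⁺ (nonzeroMultiple? q) (a≢0 , q∣a))
  ... | inj₂ p∣b | inj₂ q∣b = contradiction (p∣q∣⇒isZero b p∣b q∣b) b≢0

  p<n : p ℕ.< n
  p<n = ℕ.m<m*n p q (1<-prime q-prime)

  q<n : q ℕ.< n
  q<n = subst (q ℕ.<_) (ℕ.*-comm q p) (ℕ.m<m*n q p (1<-prime p-prime))

  -- The residue `q` serves as annihilator.
  A-vertex : ∀ {a : Fin n} → NonzeroMultiple p a → NonzeroZeroDivisor a
  A-vertex {a} (a≢0 , p∣a) = a≢0 , fromℕ< q<n
    , (λ q≡0 → contradiction (trans (sym (toℕ-fromℕ< q<n)) q≡0) (ℕ.≢-nonZero⁻¹ q))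
    , ∣ˡ∣ʳ⇒·-isZero {a} p∣a (∣-reflexive (sym (toℕ-fromℕ< q<n)))

  ·-isZero-sym : ∀ (a b : Fin n) → IsZero (a · b) → IsZero (b · a)
  ·-isZero-sym a b ab≡0 = ·-isZero⁺ b a (subst (n ∣_) (ℕ.*-comm (toℕ a) (toℕ b)) (·-isZero⁻ a b ab≡0))

  B-vertex : ∀ {a : Fin n} → NonzeroMultiple q a → NonzeroZeroDivisor a
  B-vertex {a} (a≢0 , q∣a) = a≢0 , fromℕ< p<n
    , (λ p≡0 → contradiction (trans (sym (toℕ-fromℕ< p<n)) p≡0) (ℕ.≢-nonZero⁻¹ p))
    , ·-isZero-sym (fromℕ< p<n) a (∣ˡ∣ʳ⇒·-isZero {fromℕ< p<n} {a} (∣-reflexive (sym (toℕ-fromℕ< p<n))) q∣a)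

  A∩B≡∅ : ∀ {a : Fin n} → a ∈ A → ¬ a ∈ B
  A∩B≡∅ {a} a∈A a∈B with ∈-tabulate⁻ (nonzeroMultiple? p) a∈A | ∈-tabulate⁻ (nonzeroMultiple? q) a∈B
  ... | a≢0 , p∣a | _ , q∣a = a≢0 (p∣q∣⇒isZero a p∣a q∣a)

  -- The other prime `q` would divide one of the factors, which is then divisible by both primes and
  -- hence zero.
  A-nonadjacent : ∀ {a b : Fin n} → NonzeroMultiple p a → NonzeroMultiple p b → ¬ IsZero (a · b)
  A-nonadjacent {a} {b} (a≢0 , p∣a) (b≢0 , p∣b) ab≡0 with ·-isZero⇒∣ q-prime q∣n a b ab≡0
  ... | inj₁ q∣a = a≢0 (p∣q∣⇒isZero a p∣a q∣a)
  ... | inj₂ q∣b = b≢0 (p∣q∣⇒isZero b p∣b q∣b)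

  B-nonadjacent : ∀ {a b : Fin n} → NonzeroMultiple q a → NonzeroMultiple q b → ¬ IsZero (a · b)
  B-nonadjacent {a} {b} (a≢0 , q∣a) (b≢0 , q∣b) ab≡0 with ·-isZero⇒∣ p-prime p∣n a b ab≡0
  ... | inj₁ p∣a = a≢0 (p∣q∣⇒isZero a p∣a q∣a)
  ... | inj₂ p∣b = b≢0 (p∣q∣⇒isZero b p∣b q∣b)

  independent⇐ : ∀ S → S ⊆ A ⊎ S ⊆ B → Independent (Γ n) S
  independent⇐ S (inj₁ S⊆A) =
    (λ a∈S → ∈-tabulate⁺ nonzeroZeroDivisor? (A-vertex (∈-tabulate⁻ (nonzeroMultiple? p) (S⊆A a∈S)))) ,
    λ a b a∈S b∈S (_ , _ , _ , ab≡0) → A-nonadjacent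
      (∈-tabulate⁻ (nonzeroMultiple? p) (S⊆A a∈S)) (∈-tabulate⁻ (nonzeroMultiple? p) (S⊆A b∈S)) ab≡0
  independent⇐ S (inj₂ S⊆B) =
    (λ a∈S → ∈-tabulate⁺ nonzeroZeroDivisor? (B-vertex (∈-tabulate⁻ (nonzeroMultiple? q) (S⊆B a∈S)))) ,
    λ a b a∈S b∈S (_ , _ , _ , ab≡0) → B-nonadjacent
      (∈-tabulate⁻ (nonzeroMultiple? q) (S⊆B a∈S)) (∈-tabulate⁻ (nonzeroMultiple? q) (S⊆B b∈S)) ab≡0

  -- A member `a` of `S` outside `A` lies in `B` and would be adjacent to any member of `S` in `A`.
  independent⇒ : ∀ S → Independent (Γ n) S → S ⊆ A ⊎ S ⊆ B
  independent⇒ S (S⊆V , nonadjacent) with any? (λ a → a ∈? S ×-dec ¬? (a ∈? A))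
  ... | no S⊈A = inj₁ λ {a} a∈S → decidable-stable (a ∈? A) λ a∉A → S⊈A (a , a∈S , a∉A)
  ... | yes (a , a∈S , a∉A) = inj₂ S⊆B
    where
    side : ∀ {b} → b ∈ S → b ∈ A ⊎ b ∈ B
    side b∈S = vertex⇒ (∈-tabulate⁻ nonzeroZeroDivisor? (S⊆V b∈S))
    a∈B : a ∈ B
    a∈B with side a∈S
    ... | inj₁ a∈A = contradiction a∈A a∉A
    ... | inj₂ a∈B = a∈B
    S⊆B : S ⊆ B
    S⊆B {b} b∈S with side b∈S
    ... | inj₂ b∈B = b∈B
    ... | inj₁ b∈A = contradiction
      ( S⊆V b∈S , S⊆V a∈S , (λ b≡a → a∉A (subst (_∈ A) b≡a b∈A))
      , ∣ˡ∣ʳ⇒·-isZero {b} (proj₂ (∈-tabulate⁻ (nonzeroMultiple? p) b∈A))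
                          (proj₂ (∈-tabulate⁻ (nonzeroMultiple? q) a∈B)))
      (nonadjacent b a b∈S a∈S)

  ∣A∣ : ∣ A ∣ ≡ q ℕ.∸ 1
  ∣A∣ = trans (cong (λ m → ∣ nonzeroMultiples m p ∣) (ℕ.*-comm p q)) (∣nonzeroMultiples∣ p q)

  ∣B∣ : ∣ B ∣ ≡ p ℕ.∸ 1
  ∣B∣ = ∣nonzeroMultiples∣ q p

  module _ {c ℓ} (C : CommutativeSemiring c ℓ) where
    open CommutativeSemiring C using (_≈_; 1#; rawSemiring) renaming (_+_ to _⊕_)
    open RawSemiringDefs rawSemiring using (_^_)
    open IndependencePolynomial C

    evalI-Γ : ∀ x → evalI (Γ n) x ⊕ 1# ≈ (1# ⊕ x) ^ (q ℕ.∸ 1) ⊕ (1# ⊕ x) ^ (p ℕ.∸ 1)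
    evalI-Γ x = subst₂ (λ i j → evalI (Γ n) x ⊕ 1# ≈ (1# ⊕ x) ^ i ⊕ (1# ⊕ x) ^ j) ∣A∣ ∣B∣
      (evalI-two-parts (Γ n) A B independent⇒ independent⇐ A∩B≡∅ x)

module RationalEstimates where
  open import Data.Rational.Base
    using (ℚ; 0ℚ; 1ℚ; ½; _+_; _*_; -_; _-_; _≤_; _<_) renaming (∣_∣ to abs)
  open RationalLemmas
  open UnitFractionLemmas
  open InverseLemmas
  open RootLemmas
  open PositivityLemmas
  open +-*-Solver using (solve; _:+_; _:*_; _:-_; :-_; _:=_; con)
  open RawSemiringDefs ℚ.+-*-rawSemiring using () renaming (_^_ to _^ℚ_)

  -- Gaussian rationals

  record ℚ[i] : Set where
    constructor _+i_
    field
      Re Im : ℚ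

  open ℚ[i]

  infixl 6 _+ᵍ_
  infixl 7 _*ᵍ_
  infix  8 -ᵍ_

  _+ᵍ_ _*ᵍ_ : ℚ[i] → ℚ[i] → ℚ[i]
  z +ᵍ w = (Re z + Re w) +i (Im z + Im w)
  z *ᵍ w = (Re z * Re w - Im z * Im w) +i (Re z * Im w + Im z * Re w)

  -ᵍ_ : ℚ[i] → ℚ[i]
  -ᵍ z = (- Re z) +i (- Im z)

  ι : ℚ → ℚ[i]
  ι a = a +i 0ℚ

  -- The terms of complex Cauchy sequences obey the ring laws up to `_≡_`, so the polynomial
  -- identities below can be left to a ring solver.
  ℚ[i]-commutativeRing : CommutativeRing 0ℓ 0ℓ
  ℚ[i]-commutativeRing = record
    { Carrier = ℚ[i] ; _≈_ = _≡_ ; _+_ = _+ᵍ_ ; _*_ = _*ᵍ_ ; -_ = -ᵍ_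
    ; 0# = ι 0ℚ ; 1# = ι 1ℚ
    ; isCommutativeRing = record
      { isRing = record
        { +-isAbelianGroup = record
          { isGroup = record
            { isMonoid = record
              { isSemigroup = record
                { isMagma = record { isEquivalence = isEquivalence ; ∙-cong = cong₂ _+ᵍ_ }
                ; assoc = λ z w v → cong₂ _+i_ (ℚ.+-assoc (Re z) (Re w) (Re v))
                                               (ℚ.+-assoc (Im z) (Im w) (Im v))
                }
              ; identity = (λ z → cong₂ _+i_ (ℚ.+-identityˡ (Re z)) (ℚ.+-identityˡ (Im z)))
                         , (λ z → cong₂ _+i_ (ℚ.+-identityʳ (Re z)) (ℚ.+-identityʳ (Im z)))
              }
            ; inverse = (λ z → cong₂ _+i_ (ℚ.+-inverseˡ (Re z)) (ℚ.+-inverseˡ (Im z)))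
                      , (λ z → cong₂ _+i_ (ℚ.+-inverseʳ (Re z)) (ℚ.+-inverseʳ (Im z)))
            ; ⁻¹-cong = cong -ᵍ_
            }
          ; comm = λ z w → cong₂ _+i_ (ℚ.+-comm (Re z) (Re w)) (ℚ.+-comm (Im z) (Im w))
          }
        ; *-cong = cong₂ _*ᵍ_
        ; *-assoc = λ z w v → cong₂ _+i_
            (solve 6 (λ a b c d e f →
              (a :* c :- b :* d) :* e :- (a :* d :+ b :* c) :* f
                := a :* (c :* e :- d :* f) :- b :* (c :* f :+ d :* e))
              refl (Re z) (Im z) (Re w) (Im w) (Re v) (Im v))
            (solve 6 (λ a b c d e f →
              (a :* c :- b :* d) :* f :+ (a :* d :+ b :* c) :* e
                := a :* (c :* f :+ d :* e) :+ b :* (c :* e :- d :* f))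
              refl (Re z) (Im z) (Re w) (Im w) (Re v) (Im v))
        ; *-identity = *-identityˡ , λ z → trans (*-comm z (ι 1ℚ)) (*-identityˡ z)
        ; distrib = *-distribˡ , λ z w v → trans (*-comm (w +ᵍ v) z)
            (trans (*-distribˡ z w v) (cong₂ _+ᵍ_ (*-comm z w) (*-comm z v)))
        }
      ; *-comm = *-comm
      }
    }
    where
    *-comm : ∀ z w → z *ᵍ w ≡ w *ᵍ z
    *-comm z w = cong₂ _+i_
      (solve 4 (λ a b c d → a :* c :- b :* d := c :* a :- d :* b)
        refl (Re z) (Im z) (Re w) (Im w))
      (solve 4 (λ a b c d → a :* d :+ b :* c := c :* b :+ d :* a)
        refl (Re z) (Im z) (Re w) (Im w))
    *-identityˡ : ∀ z → ι 1ℚ *ᵍ z ≡ z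
    *-identityˡ z = cong₂ _+i_
      (solve 2 (λ a b → con 1ℚ :* a :- con 0ℚ :* b := a) refl (Re z) (Im z))
      (solve 2 (λ a b → con 1ℚ :* b :+ con 0ℚ :* a := b) refl (Re z) (Im z))
    *-distribˡ : ∀ z w v → z *ᵍ (w +ᵍ v) ≡ z *ᵍ w +ᵍ z *ᵍ v
    *-distribˡ z w v = cong₂ _+i_
      (solve 6 (λ a b c d e f →
        a :* (c :+ e) :- b :* (d :+ f) := (a :* c :- b :* d) :+ (a :* e :- b :* f))
        refl (Re z) (Im z) (Re w) (Im w) (Re v) (Im v))
      (solve 6 (λ a b c d e f →
        a :* (d :+ f) :+ b :* (c :+ e) := (a :* d :+ b :* c) :+ (a :* f :+ b :* e))
        refl (Re z) (Im z) (Re w) (Im w) (Re v) (Im v))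

  open CommutativeRing ℚ[i]-commutativeRing using ()
    renaming (commutativeSemiring to ℚ[i]-commutativeSemiring; semiring to ℚ[i]-semiring)
  open RawSemiringDefs (CommutativeSemiring.rawSemiring ℚ[i]-commutativeSemiring)
    using () renaming (_^_ to _^ᵍ_; _×_ to _×ᵍ_; sum to sumᵍ)

  _≟ᵍ_ : (z w : ℚ[i]) → Dec (z ≡ w)
  (a +i b) ≟ᵍ (c +i d) = map′ (λ (a≡c , b≡d) → cong₂ _+i_ a≡c b≡d)
    (λ z≡w → cong Re z≡w , cong Im z≡w) ((a ℚ.≟ c) ×-dec (b ℚ.≟ d))

  module Gaussian = RingSolver (ACR.fromCommutativeRing ℚ[i]-commutativeRing) _≟ᵍ_

  -- Bounds on the modulus of a Gaussian rational through its square

  N : ℚ[i] → ℚ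
  N z = Re z * Re z + Im z * Im z

  N-*ᵍ : ∀ z w → N (z *ᵍ w) ≡ N z * N w
  N-*ᵍ z w = solve 4 (λ a b c d →
    (a :* c :- b :* d) :* (a :* c :- b :* d) :+ (a :* d :+ b :* c) :* (a :* d :+ b :* c)
      := (a :* a :+ b :* b) :* (c :* c :+ d :* d)) refl (Re z) (Im z) (Re w) (Im w)

  N-ι : ∀ a → N (ι a) ≡ a * a
  N-ι = solve 1 (λ a → a :* a :+ con 0ℚ :* con 0ℚ := a :* a) refl

  N--ᵍ : ∀ z → N (-ᵍ z) ≡ N z
  N--ᵍ z = solve 2 (λ a b → :- a :* :- a :+ :- b :* :- b := a :* a :+ b :* b) refl (Re z) (Im z)

  N-^ᵍ : ∀ z k → N (z ^ᵍ k) ≡ N z ^ℚ k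
  N-^ᵍ z zero    = N-ι 1ℚ
  N-^ᵍ z (suc k) = trans (N-*ᵍ z (z ^ᵍ k)) (cong (N z *_) (N-^ᵍ z k))

  0≤² : ∀ a → 0ℚ ≤ a * a
  0≤² a with ℚ.≤-total 0ℚ a
  ... | inj₁ 0≤a = 0≤* 0≤a 0≤a
  ... | inj₂ a≤0 = subst (0ℚ ≤_) (solve 1 (λ x → :- x :* :- x := x :* x) refl a) (0≤* 0≤-a 0≤-a)
    where 0≤-a = ℚ.neg-antimono-≤ a≤0

  0≤N : ∀ z → 0ℚ ≤ N z
  0≤N z = ℚ.+-mono-≤ (0≤² (Re z)) (0≤² (Im z))

  ²-cancel-≤ : ∀ {a b} → 0ℚ ≤ b → a * a ≤ b * b → a ≤ b
  ²-cancel-≤ {a} {b} 0≤b a²≤b² with a ℚ.≤? b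
  ... | yes a≤b = a≤b
  ... | no  a≰b = contradiction (ℚ.<-≤-trans (ℚ.≤-<-trans b²≤ab ab<a²) a²≤b²) (ℚ.<-irrefl refl)
    where
    b<a = ℚ.≰⇒> a≰b
    0<a = ℚ.≤-<-trans 0≤b b<a
    b²≤ab : b * b ≤ a * b
    b²≤ab = ℚ.*-monoʳ-≤-nonNeg b {{ℚ.nonNegative 0≤b}} (ℚ.<⇒≤ b<a)
    ab<a² : a * b < a * a
    ab<a² = ℚ.*-monoʳ-<-pos a {{ℚ.positive 0<a}} b<a

  -- The modulus itself may be irrational, so bounds on it are kept as bounds on its square N.
  record ∥_∥≤_ (z : ℚ[i]) (A : ℚ) : Set where
    constructor bounded-by
    field
      nonNeg : 0ℚ ≤ A
      square : N z ≤ A * A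

  open ∥_∥≤_

  ∥ι∥≤ : ∀ {a A} → abs a ≤ A → ∥ ι a ∥≤ A
  ∥ι∥≤ {a} {A} ∥a∥≤A = bounded-by (ℚ.≤-trans (ℚ.0≤∣p∣ a) ∥a∥≤A)
    (subst (_≤ A * A) (trans ∥a∥²≡a² (sym (N-ι a)))
      (*-mono-≤ (ℚ.0≤∣p∣ a) (ℚ.≤-trans (ℚ.0≤∣p∣ a) ∥a∥≤A) ∥a∥≤A ∥a∥≤A))
    where
    ∥a∥²≡a² : abs a * abs a ≡ a * a
    ∥a∥²≡a² = trans (sym (ℚ.∣p*q∣≡∣p∣*∣q∣ a a)) (ℚ.0≤p⇒∣p∣≡p (0≤² a))

  ∥ι∥≤-nonNeg : ∀ {a} → 0ℚ ≤ a → ∥ ι a ∥≤ a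
  ∥ι∥≤-nonNeg 0≤a = ∥ι∥≤ (ℚ.≤-reflexive (ℚ.0≤p⇒∣p∣≡p 0≤a))

  ∥-∥≤ : ∀ {z A} → ∥ z ∥≤ A → ∥ -ᵍ z ∥≤ A
  ∥-∥≤ {z} {A} (bounded-by 0≤A z≤A) = bounded-by 0≤A (subst (_≤ A * A) (sym (N--ᵍ z)) z≤A)

  ∥*∥≤ : ∀ {z w A B} → ∥ z ∥≤ A → ∥ w ∥≤ B → ∥ z *ᵍ w ∥≤ (A * B)
  ∥*∥≤ {z} {w} {A} {B} (bounded-by 0≤A z≤A) (bounded-by 0≤B w≤B) = bounded-by (0≤* 0≤A 0≤B)
    (subst₂ _≤_ (sym (N-*ᵍ z w))
      (solve 2 (λ a b → (a :* a) :* (b :* b) := (a :* b) :* (a :* b)) refl A B)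
      (*-mono-≤ (0≤N w) (0≤² A) z≤A w≤B))

  -- The triangle inequality: the inner product is bounded by AB because its
  -- square and that of Im (z̄ w) add up to N z N w.
  ∥+∥≤ : ∀ {z w A B} → ∥ z ∥≤ A → ∥ w ∥≤ B → ∥ z +ᵍ w ∥≤ (A + B)
  ∥+∥≤ {z} {w} {A} {B} z≤A@(bounded-by 0≤A Nz≤A²) w≤B@(bounded-by 0≤B Nw≤B²) =
    bounded-by (ℚ.+-mono-≤ 0≤A 0≤B)
      (subst₂ _≤_
        (solve 4 (λ a b c d → ((a :* a :+ b :* b) :+ (c :* c :+ d :* d))
            :+ ((a :* c :+ b :* d) :+ (a :* c :+ b :* d))
          := (a :+ c) :* (a :+ c) :+ (b :+ d) :* (b :+ d)) refl (Re z) (Im z) (Re w) (Im w))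
        (solve 2 (λ a b → (a :* a :+ b :* b) :+ (a :* b :+ a :* b) := (a :+ b) :* (a :+ b))
          refl A B)
        (ℚ.+-mono-≤ (ℚ.+-mono-≤ Nz≤A² Nw≤B²) (ℚ.+-mono-≤ inner≤AB inner≤AB)))
    where
    inner cross : ℚ
    inner = Re z * Re w + Im z * Im w
    cross = Re z * Im w - Im z * Re w
    lagrange : inner * inner + cross * cross ≡ N z * N w
    lagrange = solve 4 (λ a b c d →
      (a :* c :+ b :* d) :* (a :* c :+ b :* d) :+ (a :* d :- b :* c) :* (a :* d :- b :* c)
        := (a :* a :+ b :* b) :* (c :* c :+ d :* d)) refl (Re z) (Im z) (Re w) (Im w)
    inner≤AB : inner ≤ A * B
    inner≤AB = ²-cancel-≤ (0≤* 0≤A 0≤B) (ℚ.≤-trans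
      (subst₂ _≤_ (ℚ.+-identityʳ (inner * inner)) (trans lagrange (sym (N-*ᵍ z w)))
        (ℚ.+-monoʳ-≤ (inner * inner) (0≤² cross)))
      (square (∥*∥≤ z≤A w≤B)))

  ∥∥≤-components : ∀ {z A} → abs (Re z) ≤ ½ * A → abs (Im z) ≤ ½ * A → ∥ z ∥≤ A
  ∥∥≤-components {z} {A} re≤ im≤ =
    subst₂ ∥_∥≤_ (cong₂ _+i_ (ℚ.+-identityʳ (Re z)) (ℚ.+-identityˡ (Im z))) (half A)
      (∥+∥≤ {w = 0ℚ +i Im z} (∥ι∥≤ re≤) (bounded-by (nonNeg (∥ι∥≤ im≤))
        -- The squared moduli of `0ℚ +i Im z` and `ι (Im z)` have the same summands in opposite
        -- order.
        (subst (_≤ ½ * A * (½ * A)) (ℚ.+-comm (Im z * Im z) (0ℚ * 0ℚ)) (square (∥ι∥≤ im≤)))))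

  -- Geometric sums

  G : ℕ → ℚ → ℚ
  G zero    u = 0ℚ
  G (suc k) u = 1ℚ + u * G k u

  G-closed : ∀ k s → 1ℚ + s * G k (1ℚ + s) ≡ (1ℚ + s) ^ℚ k
  G-closed zero    s = trans (cong (1ℚ +_) (ℚ.*-zeroʳ s)) (ℚ.+-identityʳ 1ℚ)
  G-closed (suc k) s = trans
    (solve 2 (λ x g → con 1ℚ :+ x :* (con 1ℚ :+ (con 1ℚ :+ x) :* g)
                   := (con 1ℚ :+ x) :* (con 1ℚ :+ x :* g)) refl s (G k (1ℚ + s)))
    (cong ((1ℚ + s) *_) (G-closed k s))

  0≤G : ∀ k {u} → 0ℚ ≤ u → 0ℚ ≤ G k u
  0≤G zero    0≤u = ℚ.≤-refl
  0≤G (suc k) 0≤u = ℚ.+-mono-≤ (ℚ.<⇒≤ 0<1) (0≤* 0≤u (0≤G k 0≤u))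

  G-mono-≤ : ∀ k {u v} → 0ℚ ≤ u → u ≤ v → G k u ≤ G k v
  G-mono-≤ zero    0≤u u≤v = ℚ.≤-refl
  G-mono-≤ (suc k) 0≤u u≤v =
    ℚ.+-monoʳ-≤ 1ℚ (*-mono-≤ (0≤G k 0≤u) (ℚ.≤-trans 0≤u u≤v) u≤v (G-mono-≤ k 0≤u u≤v))

  1≤G : ∀ k .{{_ : NonZero k}} {u} → 0ℚ ≤ u → 1ℚ ≤ G k u
  1≤G (suc k) {u} 0≤u =
    subst (_≤ G (suc k) u) (ℚ.+-identityʳ 1ℚ) (ℚ.+-monoʳ-≤ 1ℚ (0≤* 0≤u (0≤G k 0≤u)))

  -- `G 0` and `G 1` are constant, so strictness starts at `k = 2`, where the factor multiplying `u`
  -- is positive.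
  G-mono-< : ∀ {k u v} → 2 ℕ.≤ k → 0ℚ ≤ u → u < v → G k u < G k v
  G-mono-< {suc (suc k)} {u} {v} (ℕ.s≤s (ℕ.s≤s _)) 0≤u u<v = ℚ.+-monoʳ-< 1ℚ (ℚ.<-≤-trans
    (ℚ.*-monoˡ-<-pos (G (suc k) u) {{ℚ.positive (ℚ.<-≤-trans 0<1 (1≤G (suc k) 0≤u))}} u<v)
    (ℚ.*-monoˡ-≤-nonNeg v {{ℚ.nonNegative (ℚ.≤-trans 0≤u (ℚ.<⇒≤ u<v))}}
      (G-mono-≤ (suc k) 0≤u (ℚ.<⇒≤ u<v))))

  -- The bound equals `(1 + s)^k - 1`. With `y = 1 + x`, the triangle inequality turns
  -- `y^(k+1) - 1 = y (y^k - 1) + x` into the recursion of `s * G k (1 + s)`.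
  ∥[1+x]ᵏ-1∥≤ : ∀ k {x s} → ∥ x ∥≤ s →
    ∥ (ι 1ℚ +ᵍ x) ^ᵍ k +ᵍ -ᵍ ι 1ℚ ∥≤ (s * G k (1ℚ + s))
  ∥[1+x]ᵏ-1∥≤ zero {x} {s} x≤s = subst (∥ ι 0ℚ ∥≤_) (sym (ℚ.*-zeroʳ s)) (∥ι∥≤-nonNeg ℚ.≤-refl)
  ∥[1+x]ᵏ-1∥≤ (suc k) {x} {s} x≤s = subst₂ ∥_∥≤_
    (Gaussian.solve 2 (λ x y →
      (one G.:+ x) G.:* (y G.:- one) G.:+ x G.:= (one G.:+ x) G.:* y G.:- one)
      refl x ((ι 1ℚ +ᵍ x) ^ᵍ k))
    (solve 2 (λ s g → (con 1ℚ :+ s) :* (s :* g) :+ s := s :* (con 1ℚ :+ (con 1ℚ :+ s) :* g))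
      refl s (G k (1ℚ + s)))
    (∥+∥≤ (∥*∥≤ (∥+∥≤ (∥ι∥≤-nonNeg (ℚ.<⇒≤ 0<1)) x≤s) (∥[1+x]ᵏ-1∥≤ k x≤s)) x≤s)
    where
    module G = Gaussian
    one : ∀ {n} → G.Polynomial n
    one = G.con (ι 1ℚ)

  -- Two estimates for approximate zeros of the independence polynomial

  module ℚ-Ring = CommutativeRing ℚ.+-*-commutativeRing

  ^ℚ-homo-+ : ∀ u m n → u ^ℚ (m ℕ.+ n) ≡ u ^ℚ m * u ^ℚ n
  ^ℚ-homo-+ = Exp.^-homo-* ℚ-Ring.semiring

  ^ℚ-distrib-* : ∀ u v n → (u * v) ^ℚ n ≡ u ^ℚ n * v ^ℚ n
  ^ℚ-distrib-* = CommutativeExp.^-distrib-* ℚ-Ring.commutativeSemiring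

  -- The independence polynomial of K_{a,b} at x.
  P : ℕ → ℕ → ℚ[i] → ℚ[i]
  P a b x = (ι 1ℚ +ᵍ x) ^ᵍ b +ᵍ (ι 1ℚ +ᵍ x) ^ᵍ a +ᵍ -ᵍ ι 1ℚ

  -- W a b u = (uᵇ + uᵃ - 2) / (u - 1), written so that monotonicity in u is evident.
  W : ℕ → ℕ → ℚ → ℚ
  W a b u = G b u + G a u

  -- With `y = 1 + x`, the number 1 is `P a b x` minus `(y^b - 1) + (y^a - 1)`, whose two terms are
  -- bounded by geometric sums.
  ∥P∥≤⇒1≤ : ∀ a b {x s η} → ∥ x ∥≤ s → ∥ P a b x ∥≤ η → 1ℚ ≤ η + s * W a b (1ℚ + s)
  ∥P∥≤⇒1≤ a b {x} {s} {η} x≤s P≤η = ²-cancel-≤ (nonNeg one≤)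
    (subst (_≤ bound * bound) (N-ι 1ℚ) (square one≤))
    where
    module G = Gaussian
    y = ι 1ℚ +ᵍ x
    bound = η + s * W a b (1ℚ + s)
    one : ∀ {n} → G.Polynomial n
    one = G.con (ι 1ℚ)
    one≤ : ∥ ι 1ℚ ∥≤ bound
    one≤ = subst₂ ∥_∥≤_
      (G.solve 2 (λ u v → ((u G.:+ v) G.:- one) G.:- ((u G.:- one) G.:+ (v G.:- one)) G.:= one)
        refl (y ^ᵍ b) (y ^ᵍ a))
      (cong (η +_) (sym (ℚ.*-distribˡ-+ s (G b (1ℚ + s)) (G a (1ℚ + s)))))
      (∥+∥≤ P≤η (∥-∥≤ (∥+∥≤ (∥[1+x]ᵏ-1∥≤ b x≤s) (∥[1+x]ᵏ-1∥≤ a x≤s))))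

  -- With y = 1 + x, suppose ∥y∥ > c. Then cᵃ ∥yᵈ + 1∥ ≤ ∥yᵃ (yᵈ + 1)∥ ≤ 1 + η, and
  -- hence cᵃ⁺ᵈ ≤ cᵃ ∥yᵈ∥ ≤ 1 + η + cᵃ.
  ∥P∥≤⇒∥x∥≤ : ∀ a d {c x η} → 0ℚ ≤ c → 1ℚ + η + c ^ℚ a < c ^ℚ (a ℕ.+ d) →
    ∥ P a (a ℕ.+ d) x ∥≤ η → ∥ x ∥≤ (1ℚ + c)
  ∥P∥≤⇒∥x∥≤ a d {c} {x} {η} 0≤c 1+η+cᵃ<cᵇ P≤η with N (ι 1ℚ +ᵍ x) ℚ.≤? c * c
  -- Here the triangle inequality for `x = -1 + (1 + x)` suffices.
  ... | yes Ny≤c² = subst (∥_∥≤ (1ℚ + c))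
          (Gaussian.solve 1 (λ x → Gaussian.:- (Gaussian.con (ι 1ℚ))
             Gaussian.:+ (Gaussian.con (ι 1ℚ) Gaussian.:+ x) Gaussian.:= x) refl x)
          (∥+∥≤ (∥-∥≤ (∥ι∥≤-nonNeg (ℚ.<⇒≤ 0<1))) (bounded-by {z = ι 1ℚ +ᵍ x} 0≤c Ny≤c²))
  ... | no Ny≰c² = contradiction
          (ℚ.<-≤-trans 1+η+cᵃ<cᵇ (²-cancel-≤ (nonNeg cᵃw≤) (ℚ.≤-trans cᵇ²≤ (square cᵃw≤))))
          (ℚ.<-irrefl refl)
    where
    module G = Gaussian
    y z w : ℚ[i]
    y = ι 1ℚ +ᵍ x
    z = y ^ᵍ a
    w = y ^ᵍ d
    A : ℚ
    A = c ^ℚ a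
    one : ∀ {n} → G.Polynomial n
    one = G.con (ι 1ℚ)
    c²≤Ny : c * c ≤ N y
    c²≤Ny = ℚ.<⇒≤ (ℚ.≰⇒> Ny≰c²)
    power : ∀ k → c ^ℚ k * c ^ℚ k ≤ N (y ^ᵍ k)
    power k = subst₂ _≤_ (^ℚ-distrib-* c c k) (sym (N-^ᵍ y k)) (^-mono-≤ k (0≤² c) c²≤Ny)
    z[w+1]≤ : ∥ z *ᵍ (w +ᵍ ι 1ℚ) ∥≤ (1ℚ + η)
    z[w+1]≤ = subst (∥_∥≤ (1ℚ + η))
      (trans
        (cong (λ v → ι 1ℚ +ᵍ (v +ᵍ z +ᵍ -ᵍ ι 1ℚ)) (Exp.^-homo-* ℚ[i]-semiring y a d))
        (G.solve 2 (λ z w → one G.:+ ((z G.:* w G.:+ z) G.:- one) G.:= z G.:* (w G.:+ one))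
          refl z w))
      (∥+∥≤ (∥ι∥≤-nonNeg (ℚ.<⇒≤ 0<1)) P≤η)
    -- Replacing `z` by `A`, a lower bound for its modulus, preserves the upper bound.
    cᵃ[w+1]≤ : ∥ ι A *ᵍ (w +ᵍ ι 1ℚ) ∥≤ (1ℚ + η)
    cᵃ[w+1]≤ = bounded-by (nonNeg z[w+1]≤) (ℚ.≤-trans
      (subst₂ _≤_
        (trans (cong (_* N (w +ᵍ ι 1ℚ)) (sym (N-ι A))) (sym (N-*ᵍ (ι A) (w +ᵍ ι 1ℚ))))
        (sym (N-*ᵍ z (w +ᵍ ι 1ℚ)))
        (ℚ.*-monoʳ-≤-nonNeg (N (w +ᵍ ι 1ℚ)) {{ℚ.nonNegative (0≤N (w +ᵍ ι 1ℚ))}} (power a)))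
      (square z[w+1]≤))
    cᵃw≤ : ∥ ι A *ᵍ w ∥≤ (1ℚ + η + A)
    cᵃw≤ = subst (∥_∥≤ (1ℚ + η + A))
      (G.solve 2 (λ z w → z G.:* (w G.:+ one) G.:- z G.:= z G.:* w) refl (ι A) w)
      (∥+∥≤ cᵃ[w+1]≤ (∥-∥≤ (∥ι∥≤-nonNeg (0≤^ a 0≤c))))
    cᵇ²≤ : c ^ℚ (a ℕ.+ d) * c ^ℚ (a ℕ.+ d) ≤ N (ι A *ᵍ w)
    cᵇ²≤ = subst₂ _≤_
      (trans
        (solve 2 (λ u v → (u :* u) :* (v :* v) := (u :* v) :* (u :* v)) refl A (c ^ℚ d))
        (sym (cong₂ _*_ (^ℚ-homo-+ c a d) (^ℚ-homo-+ c a d))))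
      (trans (cong (_* N w) (sym (N-ι A))) (sym (N-*ᵍ (ι A) w)))
      (ℚ.*-monoˡ-≤-nonNeg (A * A) {{ℚ.nonNegative (0≤² A)}} (power d))

  -- A rational lower bound for 2^{1/d}

  -- `rootℚ` falls back to 0 when its search finds nothing; the hypothesis on `0ℚ` covers this
  -- default.
  rootℚ-lower′ : ∀ k {x} → 0ℚ ^ℚ k ≤ x → ∀ n → rootℚ k x n ^ℚ k ≤ x
  rootℚ-lower′ k {x} 0ᵏ≤x n with rootℚ-lower k x n
  ... | inj₁ root≡0 = subst (λ r → r ^ℚ k ≤ x) (sym root≡0) 0ᵏ≤x
  ... | inj₂ root≤x = root≤x

  -- The margin `2ε` below `2^(1/d)` is split in use: one `ε` absorbs the error `1/suc n` of the
  -- computed root, the other separates `c` from its terms.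
  record RootOf2Below (a d : ℕ) : Set where
    field
      c ε       : ℚ
      0<ε       : 0ℚ < ε
      1<c       : 1ℚ < c
      [c+2ε]ᵈ≤2 : (c + (ε + ε)) ^ℚ d ≤ 1ℚ + 1ℚ
      1+cᵃ<cᵇ   : 1ℚ + c ^ℚ a < c ^ℚ (a ℕ.+ d)

  -- Since cᵃ⁺ᵈ - cᵃ tends to 2^{a/d} > 1 as c tends to 2^{1/d}, it suffices to take c close
  -- enough to 2^{1/d}. Quantitatively, 2^{1/d} > 1 + 2h, so c > 1 + h, and it is enough
  -- that cᵈ > (2 + h) / (1 + h).
  rootOf2Below : ∀ a d .{{_ : NonZero a}} .{{_ : NonZero d}} → RootOf2Below a d
  rootOf2Below a d = record
    { c = c ; ε = θ ; 0<ε = 0<θ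
    ; 1<c = ℚ.<-trans (subst (_< 1ℚ + h) (ℚ.+-identityʳ 1ℚ) (ℚ.+-monoʳ-< 1ℚ 0<h)) 1+h<c
    ; [c+2ε]ᵈ≤2 = subst (λ r → r ^ℚ d ≤ 1ℚ + 1ℚ)
        (solve 2 (λ r t → r := (r :- (t :+ t)) :+ (t :+ t)) refl r θ)
        (rootℚ-lower′ d (ℚ.≤-trans (^-mono-≤ d ℚ.≤-refl 0≤1+g) (gap-power d)) n₀)
    -- `c^(a+d)` equals `(D - 1) c^a + c^a`, and `c^a ≥ c > 1 + h` because `a` is nonzero.
    ; 1+cᵃ<cᵇ = subst₂ _<_ refl
        (trans (solve 2 (λ u v → (v :- con 1ℚ) :* u :+ u := u :* v) refl (c ^ℚ a) D)
               (sym (^ℚ-homo-+ c a d)))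
        (ℚ.+-monoˡ-< (c ^ℚ a) (ℚ.<-≤-trans 1<[D-1][1+h]
          (ℚ.*-monoˡ-≤-nonNeg (D - 1ℚ) {{ℚ.nonNegative 0≤D-1}}
            (ℚ.≤-trans (ℚ.<⇒≤ 1+h<c) (≤^ a 1≤c)))))
    }
    where
    g h K φ θ : ℚ
    g = gap d
    h = ½ * g
    -- `T d` is the slope in `(1 + φ)^d ≤ 1 + T d * φ`. The choice of `φ` gives `φ + φ * K = h`, so
    -- both `φ` and `φ * K` are at most `h`.
    K = (1ℚ + 1ℚ + h) * T d
    φ = h * invℚ (1ℚ + K)
    -- A quarter of `φ`: `c` lies `2θ` below the computed root `r`, and another `2θ` covers the
    -- error of `r`, so `c + φ` is above `2^(1/d)`.
    θ = ½ * (½ * φ)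
    0<h : 0ℚ < h
    0<h = half-pos (0<gap d)
    0≤1+g : 0ℚ ≤ 1ℚ + g
    0≤1+g = ℚ.<⇒≤ (pos+pos 0<1 (0<gap d))
    0<2+h : 0ℚ < 1ℚ + 1ℚ + h
    0<2+h = pos+pos (pos+pos 0<1 0<1) 0<h
    0≤K : 0ℚ ≤ K
    0≤K = 0≤* (ℚ.<⇒≤ 0<2+h) (0≤T d)
    0<1+K : 0ℚ < 1ℚ + K
    0<1+K = ℚ.+-mono-<-≤ 0<1 0≤K
    0<φ : 0ℚ < φ
    0<φ = pos*pos 0<h (invℚ-pos 0<1+K)
    0<θ : 0ℚ < θ
    0<θ = half-pos (half-pos 0<φ)
    ≤+ : ∀ {u v} → 0ℚ ≤ v → u ≤ u + v
    ≤+ {u} {v} 0≤v = subst (_≤ u + v) (ℚ.+-identityʳ u) (ℚ.+-monoʳ-≤ u 0≤v)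
    φ+φK≡h : φ + φ * K ≡ h
    φ+φK≡h = trans
      (solve 3 (λ h i k → h :* i :+ h :* i :* k := h :* (i :* (con 1ℚ :+ k)))
        refl h (invℚ (1ℚ + K)) K)
      (trans (cong (h *_) (invℚ-inverse 0<1+K)) (ℚ.*-identityʳ h))
    φ≤h : φ ≤ h
    φ≤h = subst (φ ≤_) φ+φK≡h (≤+ (0≤* (ℚ.<⇒≤ 0<φ) 0≤K))
    φK≤h : φ * K ≤ h
    φK≤h = subst (φ * K ≤_) (trans (ℚ.+-comm (φ * K) φ) φ+φK≡h) (≤+ (ℚ.<⇒≤ 0<φ))
    φ≤1 : φ ≤ 1ℚ
    φ≤1 = ℚ.≤-trans φ≤h (ℚ.≤-trans (subst (h ≤_) (half g) (≤+ (ℚ.<⇒≤ 0<h)))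
      (subst (g ≤_) (gap+Tgap d) (≤+ (0≤* (0≤T d) (ℚ.<⇒≤ (0<gap d))))))
    n₀ : ℕ
    n₀ = proj₁ (archimedean 0<θ)
    r c D : ℚ
    r = rootℚ d (1ℚ + 1ℚ) n₀
    c = r - (θ + θ)
    D = c ^ℚ d
    r+δ≤c+φ : r + 1/suc n₀ ≤ c + φ
    r+δ≤c+φ = ℚ.≤-trans
      (ℚ.+-monoʳ-≤ r (ℚ.≤-trans (proj₂ (archimedean 0<θ) n₀ ℕ.≤-refl) (≤+ (ℚ.<⇒≤ 0<θ))))
      (ℚ.≤-reflexive (solve 2 (λ r p → let t = con ½ :* (con ½ :* p) in
        r :+ (t :+ t) := (r :- (t :+ t)) :+ p) refl r φ))
    -- From `(1 + g)^d ≤ 2 < (r + 1/suc n₀)^d` follows `1 + g < c + φ`, and `φ ≤ h = g / 2`.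
    1+h<c : 1ℚ + h < c
    1+h<c = ℚ.≤-<-trans
      (subst (1ℚ + h ≤_)
        (solve 2 (λ g p → (con 1ℚ :+ con ½ :* g) :+ (con ½ :* g :- p) := con 1ℚ :+ g :- p)
          refl g φ)
        (≤+ (subst (_≤ h - φ) (ℚ.+-inverseʳ φ) (ℚ.+-monoˡ-≤ (- φ) φ≤h))))
      (subst (1ℚ + g - φ <_) (solve 2 (λ c p → c :+ p :- p := c) refl c φ)
        (ℚ.+-monoˡ-< (- φ) (ℚ.<-≤-trans
          (^-cancel-< d (ℚ.+-mono-≤ (rootℚ-nonNeg d (1ℚ + 1ℚ) n₀) (ℚ.<⇒≤ (0<1/suc n₀)))
            (ℚ.≤-<-trans (gap-power d) (rootℚ-upper d (1ℚ + 1ℚ) n₀)))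
          r+δ≤c+φ)))
    1≤c : 1ℚ ≤ c
    1≤c = ℚ.≤-trans (≤+ (ℚ.<⇒≤ 0<h)) (ℚ.<⇒≤ 1+h<c)
    0≤c : 0ℚ ≤ c
    0≤c = ℚ.≤-trans (ℚ.<⇒≤ 0<1) 1≤c
    0≤D-1 : 0ℚ ≤ D - 1ℚ
    0≤D-1 = subst (_≤ D - 1ℚ) (ℚ.+-inverseʳ 1ℚ) (ℚ.+-monoˡ-≤ (- 1ℚ) (1≤^ d 1≤c))
    0≤D : 0ℚ ≤ D
    0≤D = 0≤^ d 0≤c
    X : ℚ
    X = 1ℚ + T d * φ
    -- As `c ≥ 1`, the additive error becomes a factor `1 + φ`, whose power splits off from `D`.
    c+φ≤c[1+φ] : c + φ ≤ c * (1ℚ + φ)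
    c+φ≤c[1+φ] = subst₂ _≤_ (cong (c +_) (ℚ.*-identityˡ φ))
      (solve 2 (λ c p → c :+ c :* p := c :* (con 1ℚ :+ p)) refl c φ)
      (ℚ.+-monoʳ-≤ c (ℚ.*-monoʳ-≤-nonNeg φ {{ℚ.nonNegative (ℚ.<⇒≤ 0<φ)}} 1≤c))
    2<DX : 1ℚ + 1ℚ < D * X
    2<DX = ℚ.<-≤-trans (rootℚ-upper d (1ℚ + 1ℚ) n₀) (ℚ.≤-trans
      (^-mono-≤ d (ℚ.+-mono-≤ (rootℚ-nonNeg d (1ℚ + 1ℚ) n₀) (ℚ.<⇒≤ (0<1/suc n₀)))
        (ℚ.≤-trans r+δ≤c+φ c+φ≤c[1+φ]))
      (subst (_≤ D * X) (sym (^ℚ-distrib-* c (1ℚ + φ) d))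
        (ℚ.*-monoˡ-≤-nonNeg D {{ℚ.nonNegative 0≤D}} (^-chord d (ℚ.<⇒≤ 0<φ) φ≤1))))
    [2+h]X≤2+2h : (1ℚ + 1ℚ + h) * X ≤ 1ℚ + 1ℚ + h + h
    [2+h]X≤2+2h = subst (_≤ 1ℚ + 1ℚ + h + h)
      (solve 3 (λ u t p → u :+ p :* (u :* t) := u :* (con 1ℚ :+ t :* p)) refl (1ℚ + 1ℚ + h) (T d) φ)
      (ℚ.+-monoʳ-≤ (1ℚ + 1ℚ + h) φK≤h)
    -- Multiplying `2 < D * X` by `2 + h` and bounding `(2 + h) * X` by `2 + 2h` avoids dividing by
    -- `X`; the factor `½` removes the common 2.
    2+h<D[1+h] : 1ℚ + 1ℚ + h < D * (1ℚ + h)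
    2+h<D[1+h] = subst₂ _<_
      (solve 1 (λ u → con ½ :* (u :* (con 1ℚ :+ con 1ℚ)) := u) refl (1ℚ + 1ℚ + h))
      (solve 2 (λ d h → con ½ :* (d :* (con 1ℚ :+ con 1ℚ :+ h :+ h)) := d :* (con 1ℚ :+ h)) refl D h)
      (ℚ.*-monoʳ-<-pos ½ (ℚ.<-≤-trans
        (subst ((1ℚ + 1ℚ + h) * (1ℚ + 1ℚ) <_)
          (solve 3 (λ u d x → u :* (d :* x) := d :* (u :* x)) refl (1ℚ + 1ℚ + h) D X)
          (ℚ.*-monoʳ-<-pos (1ℚ + 1ℚ + h) {{ℚ.positive 0<2+h}} 2<DX))
        (ℚ.*-monoˡ-≤-nonNeg D {{ℚ.nonNegative 0≤D}} [2+h]X≤2+2h)))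
    1<[D-1][1+h] : 1ℚ < (D - 1ℚ) * (1ℚ + h)
    1<[D-1][1+h] = subst₂ _<_
      (solve 1 (λ h → con 1ℚ :+ con 1ℚ :+ h :- (con 1ℚ :+ h) := con 1ℚ) refl h)
      (solve 2 (λ d h → d :* (con 1ℚ :+ h) :- (con 1ℚ :+ h) := (d :- con 1ℚ) :* (con 1ℚ :+ h)) refl D h)
      (ℚ.+-monoˡ-< (- (1ℚ + h)) 2+h<D[1+h])

  -- The function `W` and the inner radius

  W-closed : ∀ a b e → e * W a b (1ℚ + e) ≡ (1ℚ + e) ^ℚ b + (1ℚ + e) ^ℚ a - (1ℚ + 1ℚ)
  W-closed a b e = trans
    (solve 3 (λ e g h → e :* (g :+ h)
       := (con 1ℚ :+ e :* g) :+ (con 1ℚ :+ e :* h) :- (con 1ℚ :+ con 1ℚ))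
      refl e (G b (1ℚ + e)) (G a (1ℚ + e)))
    (cong₂ (λ u v → u + v - (1ℚ + 1ℚ)) (G-closed b e) (G-closed a e))

  W-pos : ∀ a b .{{_ : NonZero b}} {u} → 0ℚ ≤ u → 0ℚ < W a b u
  W-pos a b 0≤u = ℚ.+-mono-<-≤ (ℚ.<-≤-trans 0<1 (1≤G b 0≤u)) (0≤G a 0≤u)

  W-mono-≤ : ∀ a b {u v} → 0ℚ ≤ u → u ≤ v → W a b u ≤ W a b v
  W-mono-≤ a b 0≤u u≤v = ℚ.+-mono-≤ (G-mono-≤ b 0≤u u≤v) (G-mono-≤ a 0≤u u≤v)

  W-mono-< : ∀ a {b u v} → 2 ℕ.≤ b → 0ℚ ≤ u → u < v → W a b u < W a b v
  W-mono-< a 2≤b 0≤u u<v = ℚ.+-mono-<-≤ (G-mono-< 2≤b 0≤u u<v) (G-mono-≤ a 0≤u (ℚ.<⇒≤ u<v))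

  reciprocal-≤ : ∀ {u v A B} → u * A ≡ 1ℚ → v * B ≡ 1ℚ → 0ℚ ≤ u → 0ℚ < B → A ≤ B → v ≤ u
  reciprocal-≤ {u} {v} {A} {B} uA≡1 vB≡1 0≤u 0<B A≤B = ℚ.*-cancelʳ-≤-pos B {{ℚ.positive 0<B}}
    (subst (_≤ u * B) (trans uA≡1 (sym vB≡1)) (ℚ.*-monoˡ-≤-nonNeg u {{ℚ.nonNegative 0≤u}} A≤B))

  reciprocal-< : ∀ {u v A B} → u * A ≡ 1ℚ → v * B ≡ 1ℚ → 0ℚ < u → 0ℚ < B → A < B → v < u
  reciprocal-< {u} {v} {A} {B} uA≡1 vB≡1 0<u 0<B A<B =
    ℚ.*-cancelʳ-<-nonNeg B {{ℚ.nonNegative (ℚ.<⇒≤ 0<B)}}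
      (subst (_< u * B) (trans uA≡1 (sym vB≡1)) (ℚ.*-monoʳ-<-pos u {{ℚ.positive 0<u}} A<B))

  -- s W(1 + s) = (1 + s)ᵇ + (1 + s)ᵃ - 2 is below 1 = s W(c) once 1 + s < c, and
  -- the latter holds because (c - 1) W(c) = cᵇ + cᵃ - 2 > 1.
  sW[1+s]<1 : ∀ a {b c s} → 2 ℕ.≤ b → 1ℚ < c → 1ℚ + c ^ℚ a < c ^ℚ b →
              0ℚ < s → s * W a b c ≡ 1ℚ → s * W a b (1ℚ + s) < 1ℚ
  sW[1+s]<1 a {b} {c} {s} 2≤b 1<c 1+cᵃ<cᵇ 0<s sWc≡1 =
    subst (s * W a b (1ℚ + s) <_) sWc≡1
      (ℚ.*-monoʳ-<-pos s {{ℚ.positive 0<s}}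
        (W-mono-< a 2≤b (ℚ.<⇒≤ (pos+pos 0<1 0<s)) 1+s<c))
    where
    e = c - 1ℚ
    1+e≡c : 1ℚ + e ≡ c
    1+e≡c = solve 1 (λ c → con 1ℚ :+ (c :- con 1ℚ) := c) refl c
    0≤c = ℚ.<⇒≤ (ℚ.<-trans 0<1 1<c)
    1<eW : 1ℚ < e * W a b c
    1<eW = subst (1ℚ <_)
      (sym (subst (λ u → e * W a b u ≡ u ^ℚ b + u ^ℚ a - (1ℚ + 1ℚ)) 1+e≡c (W-closed a b e)))
      (ℚ.+-monoˡ-< (- (1ℚ + 1ℚ)) (ℚ.≤-<-trans
        (ℚ.+-mono-≤ (ℚ.+-monoʳ-≤ 1ℚ (1≤^ a (ℚ.<⇒≤ 1<c))) (1≤^ a (ℚ.<⇒≤ 1<c)))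
        (ℚ.+-monoˡ-< (c ^ℚ a) 1+cᵃ<cᵇ)))
    s<e : s < e
    s<e = ℚ.*-cancelʳ-<-nonNeg (W a b c)
      {{ℚ.nonNegative (ℚ.+-mono-≤ (0≤G b 0≤c) (0≤G a 0≤c))}}
      (subst (_< e * W a b c) (sym sWc≡1) 1<eW)
    1+s<c : 1ℚ + s < c
    1+s<c = subst (1ℚ + s <_) 1+e≡c (ℚ.+-monoʳ-< 1ℚ s<e)

  slack : ∀ {u v} → u < v → ∃ λ η → 0ℚ < η × η + u < v
  slack {u} {v} u<v = ½ * (v - u) , 0<η , subst (½ * (v - u) + u <_)
    (solve 2 (λ u v → con ½ :* (v :- u) :+ (con ½ :* (v :- u) :+ u) := v) refl u v)
    (ℚ.+-monoʳ-< (½ * (v - u))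
      (subst (_< ½ * (v - u) + u) (ℚ.+-identityˡ u) (ℚ.+-monoˡ-< u 0<η)))
    where
    0<η : 0ℚ < ½ * (v - u)
    0<η = half-pos (subst (_< v - u) (ℚ.+-inverseʳ u) (ℚ.+-monoˡ-< (- u) u<v))

  -- The terms of the sequences representing complex numbers

  at : ℂ → ℕ → ℚ[i]
  at z n = seq (re z) n +i seq (im z) n

  at-^ : ∀ z k n → at (z ^ᶜ k) n ≡ at z n ^ᵍ k
  at-^ z zero    n = refl
  at-^ z (suc k) n = cong (at z n *ᵍ_) (at-^ z k n)

  at-× : ∀ k z n → at (k ×ᶜ z) n ≡ k ×ᵍ at z n
  at-× zero    z n = refl
  at-× (suc k) z n = cong (at z n +ᵍ_) (at-× k z n)

  at-sum : ∀ {m} (f : Fin m → ℂ) n → at (sumᶜ f) n ≡ sumᵍ (λ i → at (f i) n)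
  at-sum {zero}  f n = refl
  at-sum {suc m} f n = cong (at (f zero) n +ᵍ_) (at-sum (λ i → f (suc i)) n)

  open IndependencePolynomial ℚ[i]-commutativeSemiring using (evalI)
  open SemiringSum ℚ[i]-semiring using (sum-cong-≗)

  -- The operations on `ℂ` act on sequences term by term, so evaluating the polynomial commutes with
  -- taking a term.
  at-I : ∀ {m} (H : SimpleGraph m) z n → at (I H z) n ≡ evalI H (at z n)
  at-I H z n = trans (at-sum {suc (α H)} (λ k → s H (toℕ k) ×ᶜ (z ^ᶜ toℕ k)) n)
    (sum-cong-≗ {suc (α H)} λ k → trans (at-× (s H (toℕ k)) (z ^ᶜ toℕ k) n)
      (cong (s H (toℕ k) ×ᵍ_) (at-^ z (toℕ k) n)))

  ≈0⇒∥∥≤ : ∀ {z} → z ≈ᶜ 0ᶜ → ∀ {η} → 0ℚ < η → ∃ λ n₀ → ∀ n → n₀ ℕ.≤ n → ∥ at z n ∥≤ η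
  ≈0⇒∥∥≤ {z} (re≈0 , im≈0) {η} 0<η
    with re≈0 (½ * η) (half-pos 0<η) | im≈0 (½ * η) (half-pos 0<η)
  ... | l , re< | m , im< = l ℕ.⊔ m , λ n l⊔m≤n → ∥∥≤-components
    (component (seq (re z) n) (re< n (ℕ.m⊔n≤o⇒m≤o l m l⊔m≤n)))
    (component (seq (im z) n) (im< n (ℕ.m⊔n≤o⇒n≤o l m l⊔m≤n)))
    where
    component : ∀ u → abs (u - 0ℚ) < ½ * η → abs u ≤ ½ * η
    component u h = ℚ.<⇒≤ (subst (λ v → abs v < ½ * η) (ℚ.+-identityʳ u) h)

  -- The terms of a modulus round a square root down to a multiple of `1/suc n`, so a lower bound
  -- may lose one such step; upper bounds, treated next, lose nothing.
  <N⇒<rootℚ : ∀ {s X} n → 0ℚ ≤ s → s * s < X → s < rootℚ 2 X n + 1/suc n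
  <N⇒<rootℚ {s} {X} n 0≤s s²<X = ^-cancel-< 2
    (ℚ.+-mono-≤ (rootℚ-nonNeg 2 X n) (ℚ.<⇒≤ (0<1/suc n)))
    (subst (_< (rootℚ 2 X n + 1/suc n) ^ℚ 2) (cong (s *_) (sym (ℚ.*-identityʳ s)))
      (ℚ.<-trans s²<X (rootℚ-upper 2 X n)))

  ≤⇒rootℚ≤ : ∀ {t X} n → 0ℚ ≤ t → X ≤ t * t → rootℚ 2 X n ≤ t
  ≤⇒rootℚ≤ {t} {X} n 0≤t X≤t² with rootℚ-lower 2 X n
  ... | inj₁ root≡0 = subst (_≤ t) (sym root≡0) 0≤t
  ... | inj₂ root²≤X = ²-cancel-≤ 0≤t (ℚ.≤-trans
    (subst (_≤ X) (cong (rootℚ 2 X n *_) (ℚ.*-identityʳ (rootℚ 2 X n))) root²≤X) X≤t²)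

  -- (r - 1) / (rᵇ + rᵃ - 2) = 1 / W(r)
  quotient≤ : ∀ a b .{{_ : NonZero b}} {u r} → 1ℚ < u → u < r →
              (r - 1ℚ) * invℚ (r ^ℚ b + r ^ℚ a - (1ℚ + 1ℚ)) ≤ invℚ (W a b u)
  quotient≤ a b {u} {r} 1<u u<r =
    reciprocal-≤ (invℚ-inverse 0<Wu)
      (trans
        (solve 3 (λ e i w → e :* i :* w := i :* (e :* w)) refl e (invℚ D) (W a b r))
        (trans (cong (invℚ D *_) eW≡D) (invℚ-inverse 0<D)))
      (ℚ.<⇒≤ (invℚ-pos 0<Wu)) 0<Wr (W-mono-≤ a b 0≤u (ℚ.<⇒≤ u<r))
    where
    e D : ℚ
    e = r - 1ℚ
    D = r ^ℚ b + r ^ℚ a - (1ℚ + 1ℚ)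
    0≤u : 0ℚ ≤ u
    0≤u = ℚ.<⇒≤ (ℚ.<-trans 0<1 1<u)
    0<Wu : 0ℚ < W a b u
    0<Wu = W-pos a b 0≤u
    0<Wr : 0ℚ < W a b r
    0<Wr = W-pos a b (ℚ.<⇒≤ (ℚ.≤-<-trans 0≤u u<r))
    1+e≡r : 1ℚ + e ≡ r
    1+e≡r = solve 1 (λ r → con 1ℚ :+ (r :- con 1ℚ) := r) refl r
    eW≡D : e * W a b r ≡ D
    eW≡D = subst (λ u → e * W a b u ≡ u ^ℚ b + u ^ℚ a - (1ℚ + 1ℚ)) 1+e≡r (W-closed a b e)
    0<e : 0ℚ < e
    0<e = subst (_< e) (ℚ.+-inverseʳ 1ℚ) (ℚ.+-monoˡ-< (- 1ℚ) (ℚ.<-trans 1<u u<r))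
    0<D : 0ℚ < D
    0<D = subst (0ℚ <_) eW≡D (pos*pos 0<e 0<Wr)

  -- One of the two margins `ε` pays for the rounding error `δ`; the other survives.
  shift-< : ∀ {u ε r δ} → u + (ε + ε) < r + δ → δ ≤ ε → u + ε < r
  shift-< {u} {ε} {r} {δ} h δ≤ε = subst₂ _<_
    (solve 2 (λ c e → c :+ (e :+ e) :- e := c :+ e) refl u ε)
    (solve 2 (λ r e → r :+ e :- e := r) refl r ε)
    (ℚ.+-monoˡ-< (- ε) (ℚ.<-≤-trans h (ℚ.+-monoʳ-≤ r δ≤ε)))

  +ᵍ-cancel : ∀ {z w v} → z +ᵍ w ≡ v → v +ᵍ -ᵍ w ≡ z
  +ᵍ-cancel {z} {w} refl =
    Gaussian.solve 2 (λ z w → (z Gaussian.:+ w) Gaussian.:- w Gaussian.:= z) refl z w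

  -- Both bounds for the zeros of the independence polynomial of `Γ (p * q)`

  module _ {p q} (p-prime : Prime p) (q-prime : Prime q) (p<q : p ℕ.< q) where
    private
      a b d : ℕ
      a = p ℕ.∸ 1
      b = q ℕ.∸ 1
      d = q ℕ.∸ p

      2≤p : 2 ℕ.≤ p
      2≤p = 1<-prime p-prime

      2≤b : 2 ℕ.≤ b
      2≤b = ℕ.≤-trans 2≤p (ℕ.∸-monoˡ-≤ 1 p<q)

      instance
        a≢0 : NonZero a
        a≢0 = 2≤⇒nonZero-∸1 2≤p
        b≢0 : NonZero b
        b≢0 = ℕ.>-nonZero (ℕ.<⇒≤ 2≤b)
        d≢0 : NonZero d
        d≢0 = ℕ.>-nonZero (ℕ.m<n⇒0<n∸m p<q)

      a+d≡b : a ℕ.+ d ≡ b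
      a+d≡b = trans (sym (ℕ.+-∸-comm d (ℕ.<⇒≤ 2≤p))) (cong (ℕ._∸ 1) (ℕ.m+[n∸m]≡n (ℕ.<⇒≤ p<q)))

      Rₙ : ℕ → ℚ
      Rₙ = seq (R p q p<q)

    module Radii (below : RootOf2Below a d) where
      open RootOf2Below below

      private
        1+cᵃ<cᵇ′ : 1ℚ + c ^ℚ a < c ^ℚ b
        1+cᵃ<cᵇ′ = subst (λ k → 1ℚ + c ^ℚ a < c ^ℚ k) a+d≡b 1+cᵃ<cᵇ

        0<c : 0ℚ < c
        0<c = ℚ.<-trans 0<1 1<c

        c′ : ℚ
        c′ = c + ε

        c<c′ : c < c′
        c<c′ = subst (_< c′) (ℚ.+-identityʳ c) (ℚ.+-monoʳ-< c 0<ε)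

        c′<R : ∃ λ n₀ → ∀ n → n₀ ℕ.≤ n → c′ < Rₙ n
        c′<R with archimedean 0<ε
        ... | n₀ , δ≤ε = n₀ , λ n n₀≤n → shift-< {c} {ε}
          -- The powers are separated by 2: `(c + 2ε)^d ≤ 2 < (Rₙ n + 1/suc n)^d`.
          (^-cancel-< d (ℚ.+-mono-≤ (rootℚ-nonNeg d (1ℚ + 1ℚ) n) (ℚ.<⇒≤ (0<1/suc n)))
            (ℚ.≤-<-trans [c+2ε]ᵈ≤2 (rootℚ-upper d (1ℚ + 1ℚ) n)))
          (δ≤ε n n₀≤n)

        -- The formula for `r₁` with `R` replaced by `c` and by `c′`, in the form `1 / W`. As `W`
        -- increases, the terms of `r₁` are eventually at most `σ′ < σ`, while `σ` will bound the
        -- modulus of a zero from below.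
        σ σ′ : ℚ
        σ  = invℚ (W a b c)
        σ′ = invℚ (W a b c′)

        0<Wc : 0ℚ < W a b c
        0<Wc = W-pos a b (ℚ.<⇒≤ 0<c)

        0<Wc′ : 0ℚ < W a b c′
        0<Wc′ = W-pos a b (ℚ.<⇒≤ (ℚ.<-trans 0<c c<c′))

        0<σ : 0ℚ < σ
        0<σ = invℚ-pos 0<Wc

        σ′<σ : σ′ < σ
        σ′<σ = reciprocal-< (invℚ-inverse 0<Wc) (invℚ-inverse 0<Wc′) 0<σ 0<Wc′
          (W-mono-< a 2≤b (ℚ.<⇒≤ 0<c) c<c′)

        r₁≤σ′ : ∀ n → c′ < Rₙ n → seq (r₁ p q p-prime p<q) n ≤ σ′
        r₁≤σ′ n c′<Rₙ = subst (λ D → (Rₙ n - 1ℚ) * invℚ D ≤ σ′)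
          (sym (cong₂ (λ u v → u + v - (1ℚ + 1ℚ)) (seq-^ (R p q p<q) b n) (seq-^ (R p q p<q) a n)))
          (quotient≤ a b (ℚ.<-trans 1<c c<c′) c′<Rₙ)

      module _ (x : ℂ) (Ix≈0 : I (Γ (p ℕ.* q)) x ≈ᶜ 0ᶜ) where
        private
          X : ℕ → ℚ[i]
          X = at x

          P≡I : ∀ n → P a b (X n) ≡ at (I (Γ (p ℕ.* q)) x) n
          P≡I n = trans
            (+ᵍ-cancel (evalI-Γ p-prime q-prime p<q ℚ[i]-commutativeSemiring (X n)))
            (sym (at-I (Γ (p ℕ.* q)) x n))

          P-small : ∀ {η} → 0ℚ < η → ∃ λ n₀ → ∀ n → n₀ ℕ.≤ n → ∥ P a b (X n) ∥≤ η
          P-small {η} 0<η = map₂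
            (λ small n n₀≤n → subst (∥_∥≤ η) (sym (P≡I n)) (small n n₀≤n))
            (≈0⇒∥∥≤ {I (Γ (p ℕ.* q)) x} Ix≈0 0<η)

          -- A modulus of at most `σ` would contradict `∥P∥≤⇒1≤`.
          σ²<N : ∀ {η} → η + σ * W a b (1ℚ + σ) < 1ℚ →
                 ∀ n → ∥ P a b (X n) ∥≤ η → σ * σ < N (X n)
          σ²<N η+σW<1 n P≤η = ℚ.≰⇒> λ N≤σ² → ℚ.<-irrefl refl
            (ℚ.≤-<-trans (∥P∥≤⇒1≤ a b (bounded-by {z = X n} (ℚ.<⇒≤ 0<σ) N≤σ²) P≤η) η+σW<1)

        r₁<modulus : r₁ p q p-prime p<q <ᴿ modulus x
        r₁<modulus = combine
          (slack (sW[1+s]<1 a 2≤b 1<c 1+cᵃ<cᵇ′ 0<σ (invℚ-inverse 0<Wc))) (slack σ′<σ)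
          where
          combine : (∃ λ η → 0ℚ < η × η + σ * W a b (1ℚ + σ) < 1ℚ) →
                    (∃ λ τ → 0ℚ < τ × τ + σ′ < σ) → r₁ p q p-prime p<q <ᴿ modulus x
          combine (η , 0<η , η+σW<1) (τ , 0<τ , τ+σ′<σ) =
            -- Beyond `l` the terms are approximate zeros, beyond `m` those of `R` exceed `c′`,
            -- beyond `n₀` the rounding error is at most `κ`. One half `κ` of the gap `τ` pays for
            -- this error, the other is the final margin.
            κ , 0<κ , l ℕ.⊔ (m ℕ.⊔ n₀) , λ n ≤n →
              let l≤n  = ℕ.m⊔n≤o⇒m≤o l (m ℕ.⊔ n₀) ≤n
                  m≤n  = ℕ.m⊔n≤o⇒m≤o m n₀ (ℕ.m⊔n≤o⇒n≤o l (m ℕ.⊔ n₀) ≤n)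
                  n₀≤n = ℕ.m⊔n≤o⇒n≤o m n₀ (ℕ.m⊔n≤o⇒n≤o l (m ℕ.⊔ n₀) ≤n)
              in ℚ.≤-<-trans (ℚ.+-monoˡ-≤ κ (r₁≤σ′ n (proj₂ c′<R n m≤n)))
                (shift-< {σ′} {κ}
                  (ℚ.<-trans
                    (subst (_< σ) (trans (ℚ.+-comm τ σ′) (cong (σ′ +_) (sym (half τ)))) τ+σ′<σ)
                    (<N⇒<rootℚ n (ℚ.<⇒≤ 0<σ) (σ²<N η+σW<1 n (proj₂ (P-small 0<η) n l≤n))))
                  (proj₂ (archimedean 0<κ) n n₀≤n))
            where
            κ : ℚ
            κ = ½ * τ
            0<κ : 0ℚ < κ
            0<κ = half-pos 0<τ
            l m n₀ : ℕ
            l  = proj₁ (P-small 0<η)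
            m  = proj₁ c′<R
            n₀ = proj₁ (archimedean 0<κ)

        modulus<r₂ : modulus x <ᴿ r₂ p q p<q
        modulus<r₂ = combine (slack 1+cᵃ<cᵇ)
          where
          combine : (∃ λ η → 0ℚ < η × η + (1ℚ + c ^ℚ a) < c ^ℚ (a ℕ.+ d)) →
                    modulus x <ᴿ r₂ p q p<q
          combine (η , 0<η , η+1+cᵃ<cᵇ) =
            -- The margin is the distance from `c` to `c′`: the term of the modulus is at most
            -- `1 + c`, that of `r₂` is above `1 + c′`.
            ε , 0<ε , l ℕ.⊔ m , λ n ≤n →
              let x≤1+c = x≤ n (proj₂ (P-small 0<η) n (ℕ.m⊔n≤o⇒m≤o l m ≤n))
              in ℚ.≤-<-trans
                (ℚ.+-monoˡ-≤ ε (≤⇒rootℚ≤ n (nonNeg x≤1+c) (square x≤1+c)))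
                (subst (_< Rₙ n + 1ℚ) (trans (ℚ.+-comm c′ 1ℚ) (sym (ℚ.+-assoc 1ℚ c ε)))
                  (ℚ.+-monoˡ-< 1ℚ (proj₂ c′<R n (ℕ.m⊔n≤o⇒n≤o l m ≤n))))
            where
            l m : ℕ
            l = proj₁ (P-small 0<η)
            m = proj₁ c′<R
            x≤ : ∀ n → ∥ P a b (X n) ∥≤ η → ∥ X n ∥≤ (1ℚ + c)
            x≤ n P≤η = ∥P∥≤⇒∥x∥≤ a d (ℚ.<⇒≤ 0<c)
              (subst (_< c ^ℚ (a ℕ.+ d))
                (solve 2 (λ e u → e :+ (con 1ℚ :+ u) := con 1ℚ :+ e :+ u) refl η (c ^ℚ a))
                η+1+cᵃ<cᵇ)
              (subst (λ k → ∥ P a k (X n) ∥≤ η) (sym a+d≡b) P≤η)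

    annulus : ∀ x → I (Γ (p ℕ.* q)) x ≈ᶜ 0ᶜ →
              (r₁ p q p-prime p<q <ᴿ modulus x) × (modulus x <ᴿ r₂ p q p<q)
    annulus x Ix≈0 = r₁<modulus x Ix≈0 , modulus<r₂ x Ix≈0
      where open Radii (rootOf2Below a d)

open import Data.Nat using (ℕ; _<_; _*_)
open import Data.Product using (_×_)

theorem2p4 : (p q : ℕ) (p-prime : Prime p) (q-prime : Prime q) (p<q : p < q) →
    (x : ℂ) → I (Γ (p * q)) x ≈ᶜ 0ᶜ →
    (r₁ p q p-prime p<q <ᴿ modulus x) × (modulus x <ᴿ r₂ p q p<q)
theorem2p4 p q p-prime q-prime p<q = RationalEstimates.annulus p-prime q-prime p<q
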